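{- The algebra $\mathbf{PBT}$ is free (as an associative algebra) on the set $\{\mathbf{P}_T\}$, and also on the set $\{\mathbf{H}_T\}$, where $T$ runs over the nonempty binary trees whose root has no right child. Equivalently, $T$ runs over the nonempty trees whose canonical word $w_T$ is an anticonnected permutation.
   Context: For a word $w$, $\mathrm{std}(w)$ is obtained by scanning $w$ left to right and labelling $1,2,\dots$ the occurrences of its smallest letter, then the next smallest, etc. For $\sigma\in S_n$, $\mathbf{F}_\sigma=\sum_{\mathrm{std}(w)=\sigma^{ -1}}w$ in $\mathbb{K}\langle A\rangle$ ($A=\{1<2<\cdots\}$, $\mathbb{K}$ of characteristic $0$); they span the algebra $\mathbf{FQSym}$. A binary tree is empty or a node with left and right subtrees. $\mathrm{bst}(w)$ is obtained by reading $w$ right to left and inserting each letter $x$: into an empty tree create a node labeled $x$; otherwise insert recursively into the left subtree if $x\le$ root label, into the right subtree if $x>$ root label. For an unlabeled tree $T$ with $n$ nodes, $w_T\in S_n$ is the right-to-left postfix reading (right subtree, left subtree, root, recursively) of the unique labeling of $T$ by $1,\dots,n$ with each label greater than those of its left subtree and smaller than those of its right subtree. $\mathbf{P}_T=\sum_{\mathrm{shape}(\mathrm{bst}(\sigma))=T}\mathbf{F}_\sigma$; $\mathbf{PBT}$ is the subalgebra of $\mathbf{FQSym}$ spanned by the $\mathbf{P}_T$. The weak order on $S_n$ is the reflexive transitive closure of $\sigma<\sigma s_i$ whenever exchanging the letters in positions $i,i+1$ of $\sigma$ increases the number of inversions; $\mathbf{H}_T=\sum_{T'}\mathbf{P}_{T'}$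 over trees $T'$ with $w_{T'}\le w_T$ in the weak order. For $u\in S_k$, $v\in S_l$, the shifted concatenation is $u\bullet v=u\cdot v[k]$, where $v[k]$ adds $k$ to each letter; a permutation is connected if it cannot be written as $u\bullet v$ with $u,v$ nonempty, and anticonnected if its mirror image (the word read from right to left) is connected. -}

module Defs where

open import Level using (Level; _⊔_)
open import Algebra.Bundles using (CommutativeRing)
open import Data.Nat using (ℕ; zero; suc; _<_; _≤?_; _<?_)
import Data.Nat as N
open import Data.Nat.Properties using () renaming (_≟_ to _≟ℕ_)
open import Data.List using (List; []; _∷_; _++_; map; length; foldr; concatMap; filter; take; drop; upTo)
open import Data.List.Relation.Unary.All using (All)
open import Data.List.Relation.Unary.Unique.Propositional using (Unique)
import Data.List.Properties as LP
open import Data.Product using (Σ; ∃; _×_; _,_; proj₁; proj₂)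
open import Data.Empty using (⊥)
open import Data.Unit using (⊤)
open import Relation.Nullary using (¬_; Dec; yes; no)
open import Relation.Binary.PropositionalEquality using (_≡_; refl; cong; cong₂)
open import Relation.Binary.Construct.Closure.ReflexiveTransitive using (Star)

module FieldDefs {c ℓ : Level} (K : CommutativeRing c ℓ) where
  open CommutativeRing K

  ι : ℕ → Carrier
  ι zero = 0#
  ι (suc n) = 1# + ι n

  record IsFieldChar0 : Set (c ⊔ ℓ) where
    field
      nontrivial : ¬ (1# ≈ 0#)
      inverse    : ∀ x → ¬ (x ≈ 0#) → Σ Carrier (λ y → (x * y) ≈ 1#)
      char0      : ∀ n → ι n ≈ 0# → n ≡ 0

-- Words and permutations.  Alphabet A is taken to be ℕ with its usual
-- order (order-isomorphic to {1 < 2 < ...}).  Permutations of size n are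
-- words (lists) over 1..n, in one-line notation.

Word : Set
Word = List ℕ

countLt : ℕ → Word → ℕ
countLt x [] = 0
countLt x (y ∷ ys) with y <? x
... | yes _ = suc (countLt x ys)
... | no  _ = countLt x ys

countEq : ℕ → Word → ℕ
countEq x [] = 0
countEq x (y ∷ ys) with y ≟ℕ x
... | yes _ = suc (countEq x ys)
... | no  _ = countEq x ys

-- std w : the letter at position i gets label
--   1 + #(letters of w smaller than w_i) + #(occurrences of w_i before position i)
-- which is exactly the label produced by the left-to-right scanning
-- procedure (smallest letter occurrences first, left to right).
stdAux : Word → Word → Word
stdAux w [] = []
stdAux w (x ∷ xs) = suc (countLt x w N.+ countEq x (take (length w N.∸ suc (length xs)) w)) ∷ stdAux w xs

std : Word → Word
std w = stdAux w w

pos : ℕ → Word → ℕ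
pos x [] = 0
pos x (y ∷ ys) with y ≟ℕ x
... | yes _ = 1
... | no  _ = suc (pos x ys)

oneTo : ℕ → Word
oneTo n = map suc (upTo n)

inverse : Word → Word
inverse σ = map (λ k → pos k σ) (oneTo (length σ))

insertions : ℕ → Word → List Word
insertions x [] = (x ∷ []) ∷ []
insertions x (y ∷ ys) = (x ∷ y ∷ ys) ∷ map (y ∷_) (insertions x ys)

perms : Word → List Word
perms [] = [] ∷ []
perms (x ∷ xs) = concatMap (insertions x) (perms xs)

Sym : ℕ → List Word
Sym n = perms (oneTo n)

data Tree : Set where
  leaf : Tree
  node : Tree → Tree → Tree

data LTree : Set where
  lleaf : LTree
  lnode : LTree → ℕ → LTree → LTree

size : Tree → ℕ
size leaf = 0
size (node l r) = suc (size l N.+ size r)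

shape : LTree → Tree
shape lleaf = leaf
shape (lnode l _ r) = node (shape l) (shape r)

node-injˡ : ∀ {a b c d} → node a b ≡ node c d → a ≡ c
node-injˡ refl = refl

node-injʳ : ∀ {a b c d} → node a b ≡ node c d → b ≡ d
node-injʳ refl = refl

_≟T_ : (s t : Tree) → Dec (s ≡ t)
leaf ≟T leaf = yes refl
leaf ≟T node _ _ = no (λ ())
node _ _ ≟T leaf = no (λ ())
node a b ≟T node c d with a ≟T c | b ≟T d
... | yes refl | yes refl = yes refl
... | no p | _ = no (λ e → p (node-injˡ e))
... | yes _ | no q = no (λ e → q (node-injʳ e))

insert : ℕ → LTree → LTree
insert x lleaf = lnode lleaf x lleaf
insert x (lnode l y r) with x N.≤? y
... | yes _ = lnode (insert x l) y r
... | no  _ = lnode l y (insert x r)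

bst : Word → LTree
bst [] = lleaf
bst (x ∷ xs) = insert x (bst xs)

labelFrom : ℕ → Tree → LTree
labelFrom k leaf = lleaf
labelFrom k (node l r) = lnode (labelFrom k l) (suc (k N.+ size l)) (labelFrom (suc (k N.+ size l)) r)

rpostfix : LTree → Word
rpostfix lleaf = []
rpostfix (lnode l x r) = rpostfix r ++ rpostfix l ++ (x ∷ [])

wT : Tree → Word
wT T = rpostfix (labelFrom 0 T)

treesH : ℕ → List Tree
treesH zero = leaf ∷ []
treesH (suc h) = leaf ∷ concatMap (λ l → map (node l) (treesH h)) (treesH h)

-- all binary trees with n nodes (a tree with n nodes has height ≤ n)
treesOfSize : ℕ → List Tree
treesOfSize n = filter (λ t → size t ≟ℕ n) (treesH n)

RootNoRight : Tree → Set
RootNoRight leaf = ⊥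
RootNoRight (node l leaf) = ⊤
RootNoRight (node l (node _ _)) = ⊥

-- Right weak order on permutations (words):
-- σ ⟶ σ s_i when σ_i < σ_{i+1} (the swap increases the inversions)

data WStep : Word → Word → Set where
  here  : ∀ {a b} rest → a < b → WStep (a ∷ b ∷ rest) (b ∷ a ∷ rest)
  there : ∀ {x u v} → WStep u v → WStep (x ∷ u) (x ∷ v)

_≤W_ : Word → Word → Set
_≤W_ = Star WStep

module Series {c ℓ : Level} (K : CommutativeRing c ℓ) where
  open CommutativeRing K

  -- a (possibly infinite) sum of words with coefficients in K
  Ser : Set c
  Ser = Word → Carrier

  _≈S_ : Ser → Ser → Set ℓ
  f ≈S g = ∀ w → f w ≈ g w

  0S : Ser
  0S _ = 0#

  _+S_ : Ser → Ser → Ser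
  (f +S g) w = f w + g w

  _·S_ : Carrier → Ser → Ser
  (a ·S f) w = a * f w

  sumK : List Carrier → Carrier
  sumK = foldr _+_ 0#

  _*S_ : Ser → Ser → Ser
  (f *S g) w = sumK (map (λ k → f (take k w) * g (drop k w)) (upTo (suc (length w))))

  1S : Ser
  1S [] = 1#
  1S (_ ∷ _) = 0#

  sumS : List Ser → Ser
  sumS = foldr _+S_ 0S

  prodS : List Ser → Ser
  prodS = foldr _*S_ 1S

  listEq? : (u v : Word) → Dec (u ≡ v)
  listEq? = LP.≡-dec _≟ℕ_

  F : Word → Ser
  F σ w with listEq? (std w) (inverse σ)
  ... | yes _ = 1#
  ... | no  _ = 0#

  P : Tree → Ser
  P T = sumS (map F (filter (λ σ → shape (bst σ) ≟T T) (Sym (size T))))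

  H : (∀ u v → Dec (u ≤W v)) → Tree → Ser
  H dec T = sumS (map P (filter (λ T' → dec (wT T') (wT T)) (treesOfSize (size T))))

  lin : List (Carrier × Ser) → Ser
  lin cs = sumS (map (λ p → proj₁ p ·S proj₂ p) cs)

  mono : (Tree → Ser) → List Tree → Ser
  mono g ts = prodS (map g ts)

  -- element of the free algebra on the generators, evaluated
  evalFree : (Tree → Ser) → List (Carrier × List Tree) → Ser
  evalFree g cs = lin (map (λ p → proj₁ p , mono g (proj₂ p)) cs)

  InPBT : Ser → Set (c ⊔ ℓ)
  InPBT f = ∃ λ (cs : List (Carrier × Tree)) → f ≈S lin (map (λ p → proj₁ p , P (proj₂ p)) cs)

  GenWord : List Tree → Set
  GenWord = All RootNoRight

  -- PBT is free as an associative algebra on { g_T : RootNoRight T }: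
  -- the algebra morphism K⟨X_T⟩ → K⟨⟨A⟩⟩, X_T ↦ g_T, lands in PBT,
  -- is onto PBT, and is injective.
  FreeOn : (Tree → Ser) → Set (c ⊔ ℓ)
  FreeOn g =
      (∀ ts → GenWord ts → InPBT (mono g ts))
    × -- PBT contained in the image (the P_T span PBT)
      (∀ T → ∃ λ (cs : List (Carrier × List Tree)) →
               All (λ p → GenWord (proj₂ p)) cs × (P T ≈S evalFree g cs))
    × -- injectivity: the noncommutative monomials in the g_T are linearly independent
      (∀ (cs : List (Carrier × List Tree)) →
         All (λ p → GenWord (proj₂ p)) cs →
         Unique (map proj₂ cs) →
         evalFree g cs ≈S 0S →
         All (λ p → proj₁ p ≈ 0#) cs)

{-# OPTIONS --safe #-}
module Submission where

-- The tree of the inverse of std w under bst is the decreasing tree D w of w itself (cut w at its rightmost maximum),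
-- so P_T is the sum of the words w with D w = T. A product of series P_T is then computed by cutting D w at fixed
-- positions. If the root of T has no right child, P_T P_R involves P_S only for S = "T with R grafted as right subtree
-- of the root" and for trees with strictly fewer inversions in w_S. Hence the monomials in the P_T are unitriangular
-- in the basis P_S, where S is obtained by chaining the factors along its right branch. The same holds for the H_T:
-- going down in the weak order lowers the number of inversions and cannot give the root a right child, because
-- the last letter of w_T, which is its root label, only increases.

open import Defs
open import Algebra.Bundles using (CommutativeRing)
open import Data.List using (List; []; _∷_; _++_; _∷ʳ_; map; length; filter; take; drop; applyUpTo; concatMap; upTo)
open import Data.List.Membership.Propositional using (_∈_; _∉_; find; lose)
open import Data.List.Membership.Propositional.Properties
  using (∈-∃++; ∈-concatMap⁺; ∈-concatMap⁻; ∈-map⁺; ∈-map⁻; ∈-upTo⁺; ∈-upTo⁻; ∈-filter⁺; ∈-filter⁻)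
open import Data.List.Properties
  using (∷-injectiveˡ; ∷-injectiveʳ; ∷ʳ-injective; length-map; length-++; length-take; length-applyUpTo;
         map-applyUpTo; map-∘; ++-assoc; filter-accept; filter-reject; filter-all; filter-none)
open import Data.List.Relation.Binary.Disjoint.Propositional using (Disjoint)
open import Data.List.Relation.Binary.Permutation.Propositional using (_↭_; prep; swap; ↭-refl; ↭-trans; ↭-sym; ↭⇒↭ₛ)
open import Data.List.Relation.Binary.Permutation.Propositional.Properties
  using (∈-resp-↭; All-resp-↭; ↭-length; shift; drop-∷; ↭-empty-inv) renaming (map⁺ to ↭-map⁺)
import Data.List.Relation.Binary.Permutation.Setoid.Properties as Permₛ
open import Data.List.Relation.Unary.All as All using (All; []; _∷_)
import Data.List.Relation.Unary.All.Properties as Allₚ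
open import Data.List.Relation.Unary.AllPairs as AllPairs using (AllPairs; []; _∷_)
import Data.List.Relation.Unary.AllPairs.Properties as AllPairsₚ
open import Data.List.Relation.Unary.Any using (here; there)
open import Data.List.Relation.Unary.Unique.Propositional using (Unique)
import Data.List.Relation.Unary.Unique.Propositional.Properties as Uniqueₚ
open import Data.Nat using (ℕ; zero; suc; _+_; _*_; _∸_; _≤_; _<_; _≤?_; _<?_; z≤n; s≤s; s≤s⁻¹)
open import Data.Nat.Properties
open import Data.Nat.Solver using (module +-*-Solver)
open import Data.Product using (∃; _×_; _,_; proj₁; proj₂)
open import Data.Sum using (_⊎_; inj₁; inj₂)
open import Data.Unit using (tt)
open import Function using (_∘_; id; case_of_)
open import Level using (Level; _⊔_)
open import Relation.Binary.Construct.Closure.ReflexiveTransitive using (ε; _◅_)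
open import Relation.Binary.Definitions using (tri<; tri≈; tri>)
open import Relation.Binary.PropositionalEquality
  using (_≡_; _≢_; refl; sym; trans; cong; cong₂; subst; subst₂; setoid; ≢-sym; module ≡-Reasoning)
open import Relation.Nullary using (¬_; Dec; yes; no; contradiction)
open import Relation.Nullary.Decidable using (¬?)
open import Algebra.Properties.CommutativeSemigroup +-commutativeSemigroup using (x∙yz≈y∙xz)

-- Sorting the entries of a word

-- (letter , position)
Entry : Set
Entry = ℕ × ℕ

insertEntry : Entry → List Entry → List Entry
insertEntry a [] = a ∷ []
insertEntry a (b ∷ s) with proj₁ a ≤? proj₁ b
... | yes _ = a ∷ b ∷ s
... | no  _ = b ∷ insertEntry a s

-- The accumulator `t` stands for the sorted entries of a later part of the word, so that `sortOnto`
-- splits over `_++_`. Letters enter from right to left and `insertEntry` stops at an equal letter,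
-- hence ties keep their order of position.
sortOnto : ℕ → Word → List Entry → List Entry
sortOnto i []      t = t
sortOnto i (x ∷ u) t = insertEntry (x , i) (sortOnto (suc i) u t)

positions : List Entry → Word
positions = map proj₂

-- The inverse of std w: the positions of w, sorted stably by letter.
stdInverse : Word → Word
stdInverse w = positions (sortOnto 1 w [])

-- The order of tied positions is left to `sortOnto`; distinct positions are recorded so that `pos`
-- identifies a single entry.
data Before (a b : Entry) : Set where
  before : proj₁ a ≤ proj₁ b → proj₂ a ≢ proj₂ b → Before a b

Sorted : List Entry → Set
Sorted = AllPairs Before

insertEntry-↭ : ∀ a s → insertEntry a s ↭ a ∷ s
insertEntry-↭ a [] = ↭-refl
insertEntry-↭ a (b ∷ s) with proj₁ a ≤? proj₁ b
... | yes _ = ↭-refl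
... | no  _ = ↭-trans (prep b (insertEntry-↭ a s)) (swap b a ↭-refl)

insertEntry-All : ∀ {P : Entry → Set} {a s} → P a → All P s → All P (insertEntry a s)
insertEntry-All pa ps = All-resp-↭ (↭-sym (insertEntry-↭ _ _)) (pa ∷ ps)

insertEntry-first : ∀ {x i s} → All (λ b → x ≤ proj₁ b) s → insertEntry (x , i) s ≡ (x , i) ∷ s
insertEntry-first [] = refl
insertEntry-first {x} {s = b ∷ s} (x≤b ∷ _) with x ≤? proj₁ b
... | yes _ = refl
... | no ¬p = contradiction x≤b ¬p

insertEntry-last : ∀ {x i s} → All (λ b → proj₁ b < x) s → insertEntry (x , i) s ≡ s ∷ʳ (x , i)
insertEntry-last [] = refl
insertEntry-last {x} {s = b ∷ s} (b<x ∷ s<x) with x ≤? proj₁ b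
... | yes p = contradiction b<x (≤⇒≯ p)
... | no  _ = cong (b ∷_) (insertEntry-last s<x)

insertEntry-next : ∀ {x i b s} → ¬ x ≤ proj₁ b → insertEntry (x , i) (b ∷ s) ≡ b ∷ insertEntry (x , i) s
insertEntry-next {x} {b = b} x≰b with x ≤? proj₁ b
... | yes x≤b = contradiction x≤b x≰b
... | no  _   = refl

insertEntry-∷ʳ : ∀ {x m} i j s → x ≤ m → insertEntry (x , i) (s ∷ʳ (m , j)) ≡ insertEntry (x , i) s ∷ʳ (m , j)
insertEntry-∷ʳ {x} {m} i j [] x≤m = insertEntry-first (x≤m ∷ [])
insertEntry-∷ʳ {x} i j (b ∷ s) x≤m with x ≤? proj₁ b
... | yes _ = refl
... | no  _ = cong (b ∷_) (insertEntry-∷ʳ i j s x≤m)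

sorted-bound : ∀ {x b s} → x ≤ proj₁ b → All (Before b) s → All (λ a → x ≤ proj₁ a) (b ∷ s)
sorted-bound x≤b b≤s = x≤b ∷ All.map (λ { (before p _) → ≤-trans x≤b p }) b≤s

insertEntry-sorted : ∀ {a s} → All (λ b → proj₂ a ≢ proj₂ b) s → Sorted s → Sorted (insertEntry a s)
insertEntry-sorted [] [] = [] ∷ []
insertEntry-sorted {a} {b ∷ s} (a≢b ∷ a≢s) (b≤s ∷ ss) with proj₁ a ≤? proj₁ b
... | yes a≤b = (before a≤b a≢b ∷ All.zipWith (λ { (before q _ , n) → before (≤-trans a≤b q) n })
    (b≤s , a≢s)) ∷ b≤s ∷ ss
... | no  a≰b = insertEntry-All (before (<⇒≤ (≰⇒> a≰b)) (≢-sym a≢b)) b≤s ∷ insertEntry-sorted a≢s ss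

sortOnto-++ : ∀ i u v t → sortOnto i (u ++ v) t ≡ sortOnto i u (sortOnto (length u + i) v t)
sortOnto-++ i [] v t = refl
sortOnto-++ i (x ∷ u) v t rewrite sym (+-suc (length u) i) = cong (insertEntry (x , i))
    (sortOnto-++ (suc i) u v t)

sortOnto-letters : ∀ {P : ℕ → Set} i {u t} → All P u → All (P ∘ proj₁) t → All (P ∘ proj₁) (sortOnto i u t)
sortOnto-letters i [] pt = pt
sortOnto-letters i (px ∷ pu) pt = insertEntry-All px (sortOnto-letters (suc i) pu pt)

sortOnto-positions : ∀ {j} i u {t} → j ≤ i → All (λ b → j ≤ proj₂ b) t →
  All (λ b → j ≤ proj₂ b) (sortOnto i u t)
sortOnto-positions i []      _   pt = pt
sortOnto-positions i (x ∷ u) j≤i pt = insertEntry-All j≤i (sortOnto-positions (suc i) u (m≤n⇒m≤1+n j≤i) pt)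

sort-fresh : ∀ i u → All (λ b → i ≢ proj₂ b) (sortOnto (suc i) u [])
sort-fresh i u = All.map <⇒≢ (sortOnto-positions (suc i) u ≤-refl [])

sortOnto-sorted : ∀ i u {t} → All (λ b → length u + i ≤ proj₂ b) t → Sorted t → Sorted (sortOnto i u t)
sortOnto-sorted i [] _ st = st
sortOnto-sorted i (x ∷ u) {t} pt st = insertEntry-sorted
  (All.map <⇒≢ (sortOnto-positions (suc i) u ≤-refl (All.map (≤-trans (s≤s (m≤n+m i (length u)))) pt)))
  (sortOnto-sorted (suc i) u (All.map (≤-trans (≤-reflexive (+-suc (length u) i))) pt) st)

sort-sorted : ∀ i u → Sorted (sortOnto i u [])
sort-sorted i u = sortOnto-sorted i u [] []

sortOnto-∷ʳ : ∀ {m j} i u {t} → All (_≤ m) u → sortOnto i u (t ∷ʳ (m , j)) ≡ sortOnto i u t ∷ʳ (m , j)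
sortOnto-∷ʳ i [] [] = refl
sortOnto-∷ʳ {m} {j} i (x ∷ u) {t} (x≤m ∷ u≤m) =
  trans (cong (insertEntry (x , i)) (sortOnto-∷ʳ (suc i) u u≤m)) (insertEntry-∷ʳ i j (sortOnto (suc i) u t) x≤m)

-- The letters of `v` are strictly smaller than `m`, so the entry of `m` goes to the end, and the
-- letters of `u`, at most `m`, never pass it. As `bst` reads from the right, the position of the
-- rightmost maximum becomes the root.
sort-lastMaximum : ∀ {m} i u v → All (_≤ m) u → All (_< m) v →
  sortOnto i (u ++ m ∷ v) [] ≡ sortOnto i u (sortOnto (suc (length u + i)) v []) ∷ʳ (m , length u + i)
sort-lastMaximum {m} i u v u≤m v<m =
  trans (sortOnto-++ i u (m ∷ v) [])
  (trans (cong (sortOnto i u) (insertEntry-last (sortOnto-letters (suc (length u + i)) v<m [])))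
         (sortOnto-∷ʳ i u u≤m))

-- Splitting a sorted list by position, and its binary search tree

module _ (j : ℕ) where

  upTo? = λ (b : Entry) → proj₂ b ≤? j
  after? = λ (b : Entry) → ¬? (proj₂ b ≤? j)

  -- The insertion may stop at an entry that the filter removes; sortedness ensures that it then
  -- also stops at the head of what remains.
  filter-insertEntry : ∀ {x i s} → i ≤ j → Sorted s →
    filter upTo? (insertEntry (x , i) s) ≡ insertEntry (x , i) (filter upTo? s)
  filter-insertEntry i≤j [] = filter-accept upTo? i≤j
  filter-insertEntry {x} {i} {b ∷ s} i≤j (b≤s ∷ ss) with x ≤? proj₁ b
  ... | yes x≤b = trans (filter-accept upTo? i≤j)
          (sym (insertEntry-first (Allₚ.filter⁺ upTo? (sorted-bound x≤b b≤s))))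
  ... | no  x≰b with proj₂ b ≤? j
  ...   | no  b≰j = trans (filter-reject upTo? b≰j) (trans (filter-insertEntry i≤j ss)
          (cong (insertEntry (x , i)) (sym (filter-reject upTo? b≰j))))
  ...   | yes b≤j = trans (filter-accept upTo? b≤j) (trans (cong (b ∷_) (filter-insertEntry i≤j ss))
          (trans (sym (insertEntry-next x≰b)) (cong (insertEntry (x , i)) (sym (filter-accept upTo? b≤j)))))

  filter-insertEntry-reject : ∀ {a} s → proj₂ a ≤ j → filter after? (insertEntry a s) ≡ filter after? s
  filter-insertEntry-reject [] a≤j = filter-reject after? (λ q → q a≤j)
  filter-insertEntry-reject {a} (b ∷ s) a≤j with proj₁ a ≤? proj₁ b
  ... | yes _ = filter-reject after? (λ q → q a≤j)
  ... | no  _ with proj₂ b ≤? j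
  ...   | yes b≤j = trans (filter-reject after? (λ q → q b≤j))
          (trans (filter-insertEntry-reject s a≤j) (sym (filter-reject after? (λ q → q b≤j))))
  ...   | no  b≰j = trans (filter-accept after? b≰j)
          (trans (cong (b ∷_) (filter-insertEntry-reject s a≤j)) (sym (filter-accept after? b≰j)))

  filter-upTo-sortOnto : ∀ i u {t} → length u + i ≤ suc j → All (λ b → suc j ≤ proj₂ b) t → Sorted t →
    filter upTo? (sortOnto i u t) ≡ sortOnto i u []
  filter-upTo-sortOnto i [] _ pt st = filter-none upTo? (All.map <⇒≱ pt)
  filter-upTo-sortOnto i (x ∷ u) h pt st = trans
    (filter-insertEntry (≤-trans (m≤n+m i (length u)) (s≤s⁻¹ h))
       (sortOnto-sorted (suc i) u (All.map (≤-trans h′) pt) st))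
    (cong (insertEntry (x , i)) (filter-upTo-sortOnto (suc i) u h′ pt st))
    where
    h′ = ≤-trans (≤-reflexive (+-suc (length u) i)) h

  filter-after-sortOnto : ∀ i u {t} → length u + i ≤ suc j → All (λ b → suc j ≤ proj₂ b) t →
    filter after? (sortOnto i u t) ≡ t
  filter-after-sortOnto i [] _ pt = filter-all after? (All.map <⇒≱ pt)
  filter-after-sortOnto i (x ∷ u) h pt = trans
    (filter-insertEntry-reject (sortOnto (suc i) u _) (≤-trans (m≤n+m i (length u)) (s≤s⁻¹ h)))
    (filter-after-sortOnto (suc i) u (≤-trans (≤-reflexive (+-suc (length u) i)) h) pt)

  -- The last entry is inserted first, so `j` is the root. Every later insertion goes left or right
  -- by comparison with `j`, and the order within each side is kept.
  bst-∷ʳ : ∀ {m} s → bst (positions (s ∷ʳ (m , j))) ≡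
    lnode (bst (positions (filter upTo? s))) j (bst (positions (filter after? s)))
  bst-∷ʳ [] = refl
  bst-∷ʳ {m} (b ∷ s) rewrite bst-∷ʳ {m} s with proj₂ b ≤? j
  ... | yes b≤j = sym (cong₂ (λ t t′ → lnode (bst (positions t)) j (bst (positions t′)))
          (filter-accept upTo? {xs = s} b≤j) (filter-reject after? {xs = s} (λ q → q b≤j)))
  ... | no  b≰j = sym (cong₂ (λ t t′ → lnode (bst (positions t)) j (bst (positions t′)))
          (filter-reject upTo? {xs = s} b≰j) (filter-accept after? {xs = s} b≰j))

-- w ≻ T: the decreasing tree of w has shape T. Ties are broken in favour of the rightmost maximum, as std does.
data _≻_ : Word → Tree → Set where
  empty : [] ≻ leaf
  split : ∀ {u m v l r} → All (_≤ m) u → All (_< m) v → u ≻ l → v ≻ r → (u ++ m ∷ v) ≻ node l r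

decreasingTree : Word → Tree
decreasingTree w = shape (bst (stdInverse w))

-- The rightmost maximum, at position `length u + i`, is the root, and the two filters give back the
-- sorted entries of `u` and of `v`. The starting position is arbitrary because `v` starts later
-- than `u`.
bst-sort : ∀ {w T} i → w ≻ T → shape (bst (positions (sortOnto i w []))) ≡ T
bst-sort i empty = refl
bst-sort i (split {u} {m} {v} u≤m v<m u≻l v≻r)
  rewrite sort-lastMaximum i u v u≤m v<m
        | bst-∷ʳ (length u + i) {m} (sortOnto i u (sortOnto (suc (length u + i)) v []))
        | filter-upTo-sortOnto (length u + i) i u (n≤1+n _)
            (sortOnto-positions (suc (length u + i)) v ≤-refl []) (sort-sorted (suc (length u + i)) v)
        | filter-after-sortOnto (length u + i) i u (n≤1+n _)
            (sortOnto-positions (suc (length u + i)) v ≤-refl [])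
  = cong₂ node (bst-sort i u≻l) (bst-sort (suc (length u + i)) v≻r)

≻⇒≡ : ∀ {w T} → w ≻ T → decreasingTree w ≡ T
≻⇒≡ = bst-sort 1

-- A new first letter either passes into the left part, when it is at most the maximum, or becomes
-- the strict maximum with the whole word to its right.
≻-∷ : ∀ x {w T} → w ≻ T → ∃ λ T′ → (x ∷ w) ≻ T′
≻-∷ x empty = _ , split [] [] empty empty
≻-∷ x p@(split {u} {m} u≤m v<m u≻l v≻r) with x ≤? m
... | yes x≤m = _ , split (x≤m ∷ u≤m) v<m (proj₂ (≻-∷ x u≻l)) v≻r
... | no  x≰m = _ , split [] (Allₚ.++⁺ (All.map (λ q → ≤-<-trans q m<x) u≤m)
    (m<x ∷ All.map (λ q → <-trans q m<x) v<m)) empty p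
  where m<x = ≰⇒> x≰m

≻-total : ∀ w → ∃ λ T → w ≻ T
≻-total [] = leaf , empty
≻-total (x ∷ w) = ≻-∷ x (proj₂ (≻-total w))

≻-decreasingTree : ∀ w → w ≻ decreasingTree w
≻-decreasingTree w = subst (w ≻_) (sym (≻⇒≡ (proj₂ (≻-total w)))) (proj₂ (≻-total w))

≻-size : ∀ {w T} → w ≻ T → length w ≡ size T
≻-size empty = refl
≻-size (split {u} {m} {v} _ _ p q) = trans (length-++ u)
    (trans (+-suc (length u) (length v)) (cong suc (cong₂ _+_ (≻-size p) (≻-size q))))

-- The inverse of the standardization

countLt-∷ : ∀ x y w → countLt x (y ∷ w) ≡ countLt x (y ∷ []) + countLt x w
countLt-∷ x y w with y <? x
... | yes _ = refl
... | no  _ = refl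

countLt-swap : ∀ x y z w → countLt x (y ∷ z ∷ w) ≡ countLt x (z ∷ y ∷ w)
countLt-swap x y z w rewrite countLt-∷ x y (z ∷ w) | countLt-∷ x z (y ∷ w) | countLt-∷ x z w | countLt-∷ x y w =
  x∙yz≈y∙xz (countLt x (y ∷ [])) (countLt x (z ∷ [])) (countLt x w)

countLt-prep : ∀ x y {u v} → countLt x u ≡ countLt x v → countLt x (y ∷ u) ≡ countLt x (y ∷ v)
countLt-prep x y {u} {v} eq = trans (countLt-∷ x y u)
    (trans (cong (countLt x (y ∷ []) +_) eq) (sym (countLt-∷ x y v)))

countLt-↭ : ∀ x {u v} → u ↭ v → countLt x u ≡ countLt x v
countLt-↭ x _↭_.refl = refl
countLt-↭ x (prep y p) = countLt-prep x y (countLt-↭ x p)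
countLt-↭ x {y ∷ z ∷ u} (swap y z p) = trans (countLt-swap x y z u)
    (countLt-prep x z (countLt-prep x y (countLt-↭ x p)))
countLt-↭ x (_↭_.trans p q) = trans (countLt-↭ x p) (countLt-↭ x q)

countLt-accept : ∀ {x y} w → y < x → countLt x (y ∷ w) ≡ suc (countLt x w)
countLt-accept {x} {y} w y<x with y <? x
... | yes _ = refl
... | no ¬p = contradiction y<x ¬p

countLt-reject : ∀ {x y} w → x ≤ y → countLt x (y ∷ w) ≡ countLt x w
countLt-reject {x} {y} w x≤y with y <? x
... | yes p = contradiction p (≤⇒≯ x≤y)
... | no _ = refl

countLt-none : ∀ {x w} → All (x ≤_) w → countLt x w ≡ 0
countLt-none [] = refl
countLt-none (x≤y ∷ p) = trans (countLt-reject _ x≤y) (countLt-none p)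

countEq-accept : ∀ x w → countEq x (x ∷ w) ≡ suc (countEq x w)
countEq-accept x w with x ≟ x
... | yes _ = refl
... | no ¬p = contradiction refl ¬p

countEq-reject : ∀ {x y} w → y ≢ x → countEq x (y ∷ w) ≡ countEq x w
countEq-reject {x} {y} w y≢x with y ≟ x
... | yes p = contradiction p y≢x
... | no _ = refl

pos-here : ∀ x w → pos x (x ∷ w) ≡ 1
pos-here x w with x ≟ x
... | yes _ = refl
... | no ¬p = contradiction refl ¬p

pos-there : ∀ {x y} w → y ≢ x → pos x (y ∷ w) ≡ suc (pos x w)
pos-there {x} {y} w y≢x with y ≟ x
... | yes p = contradiction p y≢x
... | no _ = refl

letters-sort : ∀ i u → map proj₁ (sortOnto i u []) ↭ u
letters-sort i [] = ↭-refl
letters-sort i (x ∷ u) = ↭-trans (↭-map⁺ proj₁ (insertEntry-↭ (x , i) (sortOnto (suc i) u [])))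
    (prep x (letters-sort (suc i) u))

positions-sort : ∀ i u f → (∀ k → f k ≡ k + i) → positions (sortOnto i u []) ↭ applyUpTo f (length u)
positions-sort i [] f f≗ = ↭-refl
positions-sort i (x ∷ u) f f≗ rewrite f≗ 0 = ↭-trans
    (↭-map⁺ proj₂ (insertEntry-↭ (x , i) (sortOnto (suc i) u [])))
  (prep i (positions-sort (suc i) u (f ∘ suc) (λ k → trans (f≗ (suc k)) (sym (+-suc k i)))))

stdInverse-↭ : ∀ w → stdInverse w ↭ oneTo (length w)
stdInverse-↭ w rewrite map-applyUpTo id suc (length w) = positions-sort 1 w suc (λ k → sym (+-comm k 1))

sort-∈ : ∀ i a x b → (x , length a + i) ∈ sortOnto i (a ++ x ∷ b) []
sort-∈ i [] x b = ∈-resp-↭ (↭-sym (insertEntry-↭ (x , i) (sortOnto (suc i) b []))) (here refl)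
sort-∈ i (y ∷ a) x b = ∈-resp-↭ (↭-sym (insertEntry-↭ (y , i) (sortOnto (suc i) (a ++ x ∷ b) [])))
  (there (subst (λ k → (x , k) ∈ sortOnto (suc i) (a ++ x ∷ b) []) (+-suc (length a) i) (sort-∈ (suc i) a x b)))

-- The new entry stands before its equals, so exactly the strictly smaller letters precede it.
pos-inserted : ∀ {x i s} → All (λ b → i ≢ proj₂ b) s → Sorted s →
  pos i (positions (insertEntry (x , i) s)) ≡ suc (countLt x (map proj₁ s))
pos-inserted {x} {i} [] [] = pos-here i []
pos-inserted {x} {i} {b ∷ s} (i≢b ∷ i≢s) (b≤s ∷ ss) with x ≤? proj₁ b
... | yes x≤b = trans (pos-here i _) (cong suc (sym (countLt-none (Allₚ.map⁺ (sorted-bound x≤b b≤s)))))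
... | no  x≰b = trans (pos-there _ (≢-sym i≢b))
    (cong suc (trans (pos-inserted i≢s ss) (sym (countLt-accept (map proj₁ s) (≰⇒> x≰b)))))

pos-insert-before : ∀ {x y i j s} → i ≢ j → Sorted s → (y , j) ∈ s → x ≤ y →
  pos j (positions (insertEntry (x , i) s)) ≡ suc (pos j (positions s))
pos-insert-before {x} {y} {i} {j} {b ∷ s} i≢j (b≤s ∷ ss) y∈s x≤y with x ≤? proj₁ b
... | yes _ = pos-there _ i≢j
pos-insert-before i≢j (b≤s ∷ ss) (here refl) x≤y | no x≰b = contradiction x≤y x≰b
pos-insert-before {j = j} {b ∷ s} i≢j (b≤s ∷ ss) (there y∈s) x≤y | no x≰b with All.lookup b≤s y∈s
... | before _ b≢j = trans (pos-there _ b≢j)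
    (cong suc (trans (pos-insert-before i≢j ss y∈s x≤y) (sym (pos-there (positions s) b≢j))))

pos-insert-after : ∀ {x y i j s} → Sorted s → (y , j) ∈ s → y < x →
  pos j (positions (insertEntry (x , i) s)) ≡ pos j (positions s)
pos-insert-after {x} {y} {i} {j} {b ∷ s} (b≤s ∷ ss) y∈s y<x with x ≤? proj₁ b
pos-insert-after (b≤s ∷ ss) (here refl) y<x | yes x≤b = contradiction y<x (≤⇒≯ x≤b)
pos-insert-after (b≤s ∷ ss) (there y∈s) y<x | yes x≤b with All.lookup b≤s y∈s
... | before b≤y _ = contradiction y<x (≤⇒≯ (≤-trans x≤b b≤y))
pos-insert-after {j = j} (b≤s ∷ ss) (here refl) y<x | no x≰b = trans (pos-here j _) (sym (pos-here j _))
pos-insert-after {j = j} {b ∷ s} (b≤s ∷ ss) (there y∈s) y<x | no x≰b with All.lookup b≤s y∈s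
... | before _ b≢j = trans (pos-there _ b≢j)
    (trans (cong suc (pos-insert-after ss y∈s y<x)) (sym (pos-there (positions s) b≢j)))

-- The right-hand side is the label that `std` gives to `x`. Inserting an earlier letter `y` shifts
-- the entry of `x` by one exactly when `y ≤ x`; `countLt` accounts for a smaller `y` and `countEq`
-- for an equal one.
pos-sort : ∀ i a x b →
  pos (length a + i) (positions (sortOnto i (a ++ x ∷ b) [])) ≡ suc (countLt x (a ++ x ∷ b) + countEq x a)
pos-sort i [] x b = trans (pos-inserted (sort-fresh i b) (sort-sorted (suc i) b))
  (cong suc (trans (countLt-↭ x (letters-sort (suc i) b))
      (sym (trans (+-identityʳ _) (countLt-reject b ≤-refl)))))
pos-sort i (y ∷ a) x b with <-cmp y x
... | tri< y<x y≢x _ rewrite countLt-accept (a ++ x ∷ b) y<x | countEq-reject a y≢x | sym (+-suc (length a) i) =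
  trans (pos-insert-before (All.lookup (sort-fresh i (a ++ x ∷ b)) (sort-∈ (suc i) a x b))
      (sort-sorted (suc i) (a ++ x ∷ b)) (sort-∈ (suc i) a x b) (<⇒≤ y<x))
        (cong suc (pos-sort (suc i) a x b))

... | tri≈ _ refl _ rewrite countLt-reject {x} (a ++ x ∷ b) ≤-refl | countEq-accept x a
    | sym (+-suc (length a) i) | +-suc (countLt x (a ++ x ∷ b)) (countEq x a) =
  trans (pos-insert-before (All.lookup (sort-fresh i (a ++ x ∷ b)) (sort-∈ (suc i) a x b))
      (sort-sorted (suc i) (a ++ x ∷ b)) (sort-∈ (suc i) a x b) ≤-refl)
        (cong suc (pos-sort (suc i) a x b))
... | tri> _ y≢x x<y rewrite countLt-reject (a ++ x ∷ b) (<⇒≤ x<y) | countEq-reject a y≢x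
    | sym (+-suc (length a) i) =
  trans (pos-insert-after (sort-sorted (suc i) (a ++ x ∷ b)) (sort-∈ (suc i) a x b) x<y)
      (pos-sort (suc i) a x b)

take-length-++ : ∀ {A : Set} (a b : List A) → take (length a) (a ++ b) ≡ a
take-length-++ [] b = refl
take-length-++ (x ∷ a) b = cong (x ∷_) (take-length-++ a b)

take-prefix : ∀ (a : Word) x b → take (length (a ++ x ∷ b) ∸ suc (length b)) (a ++ x ∷ b) ≡ a
take-prefix a x b = trans (cong (λ n → take n (a ++ x ∷ b))
    (trans (cong (_∸ suc (length b)) (length-++ a)) (m+n∸n≡m (length a) (suc (length b)))))
  (take-length-++ a (x ∷ b))

-- Generalised over the prefix `a` already scanned, which `stdAux` recovers from lengths; `f` is
-- abstract so that it can be shifted along `applyUpTo`.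
stdAux-pos : ∀ a b {w} f → w ≡ a ++ b → (∀ k → f k ≡ pos (length a + suc k) (stdInverse w)) →
  stdAux w b ≡ applyUpTo f (length b)
stdAux-pos a [] f _ _ = refl
stdAux-pos a (x ∷ b) f refl f≗ = cong₂ _∷_
  (sym (trans (f≗ 0) (trans (pos-sort 1 a x b)
    (cong (λ u → suc (countLt x (a ++ x ∷ b) + countEq x u)) (sym (take-prefix a x b))))))
  (stdAux-pos (a ∷ʳ x) b (f ∘ suc) (sym (++-assoc a (x ∷ []) b))
    (λ k → trans (f≗ (suc k)) (cong (λ n → pos n (stdInverse (a ++ x ∷ b)))
      (trans (sym (+-assoc (length a) 1 (suc k))) (cong (_+ suc k) (sym (length-++ a)))))))

length-oneTo : ∀ n → length (oneTo n) ≡ n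
length-oneTo n = trans (length-map suc (upTo n)) (length-applyUpTo id n)

length-stdInverse : ∀ w → length (stdInverse w) ≡ length w
length-stdInverse w = trans (↭-length (stdInverse-↭ w)) (length-oneTo (length w))

inverse-stdInverse : ∀ w → std w ≡ inverse (stdInverse w)
inverse-stdInverse w rewrite length-stdInverse w | map-applyUpTo id suc (length w)
  | map-applyUpTo suc (λ k → pos k (stdInverse w)) (length w) =
  stdAux-pos [] w _ refl (λ _ → refl)

length-std : ∀ w → length (std w) ≡ length w
length-std w = trans (cong length (stdAux-pos [] w _ refl (λ _ → refl)))
    (length-applyUpTo (λ k → pos (suc k) (stdInverse w)) (length w))

-- Permutations

insertions-↭ : ∀ x p {q} → q ∈ insertions x p → q ↭ x ∷ p
insertions-↭ x [] (here refl) = ↭-refl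
insertions-↭ x (y ∷ p) (here refl) = ↭-refl
insertions-↭ x (y ∷ p) (there q∈) with ∈-map⁻ (y ∷_) q∈
... | _ , q′∈ , refl = ↭-trans (prep y (insertions-↭ x p q′∈)) (swap y x ↭-refl)

perms-↭ : ∀ xs {σ} → σ ∈ perms xs → σ ↭ xs
perms-↭ [] (here refl) = ↭-refl
perms-↭ (x ∷ xs) σ∈ with find (∈-concatMap⁻ (insertions x) {xs = perms xs} σ∈)
... | p , p∈ , σ∈p = ↭-trans (insertions-↭ x p σ∈p) (prep x (perms-↭ xs p∈))

∈-insertions : ∀ x a b → (a ++ x ∷ b) ∈ insertions x (a ++ b)
∈-insertions x [] [] = here refl
∈-insertions x [] (y ∷ b) = here refl
∈-insertions x (y ∷ a) b = there (∈-map⁺ (y ∷_) (∈-insertions x a b))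

∈-perms : ∀ xs {σ} → σ ↭ xs → σ ∈ perms xs
∈-perms [] σ↭ with refl ← ↭-empty-inv σ↭ = here refl
∈-perms (x ∷ xs) σ↭ with ∈-∃++ (∈-resp-↭ (↭-sym σ↭) (here refl))
... | a , b , refl = ∈-concatMap⁺ (insertions x)
  (lose (∈-perms xs (drop-∷ (↭-trans (↭-sym (shift x a b)) σ↭))) (∈-insertions x a b))

insertions-unique : ∀ {x p} → x ∉ p → Unique (insertions x p)
insertions-unique {p = []} x∉ = [] ∷ []
insertions-unique {x} {y ∷ p} x∉ = Allₚ.map⁺
    (All.universal (λ _ eq → x∉ (here (∷-injectiveˡ eq))) (insertions x p))
  ∷ Uniqueₚ.map⁺ ∷-injectiveʳ (insertions-unique (x∉ ∘ there))

-- Deletion is a left inverse of insertion, which makes the insertion lists of different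
-- permutations disjoint in `perms-unique`.
insertions-delete : ∀ {x} p {q} → x ∉ p → q ∈ insertions x p → filter (λ y → ¬? (y ≟ x)) q ≡ p
insertions-delete {x} [] x∉ (here refl) = filter-reject (λ y → ¬? (y ≟ x)) (λ n → n refl)
insertions-delete {x} (y ∷ p) x∉ (here refl) = trans (filter-reject (λ y → ¬? (y ≟ x)) (λ n → n refl))
  (filter-all (λ y → ¬? (y ≟ x)) (All.tabulate (λ y∈ y≡x → x∉ (subst (_∈ _) y≡x y∈))))
insertions-delete {x} (y ∷ p) x∉ (there q∈) with ∈-map⁻ (y ∷_) q∈
... | _ , q′∈ , refl = trans (filter-accept (λ y → ¬? (y ≟ x)) (λ y≡x → x∉ (here (sym y≡x))))
    (cong (y ∷_) (insertions-delete p (x∉ ∘ there) q′∈))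

perms-unique : ∀ {xs} → Unique xs → Unique (perms xs)
perms-unique [] = [] ∷ []
perms-unique {x ∷ xs} (x∉ ∷ xs!) = Uniqueₚ.concat⁺
  (Allₚ.map⁺ (All.tabulate (λ p∈ → insertions-unique (fresh p∈))))
  (AllPairsₚ.map⁺ (disjoint (λ p∈ → p∈) (perms-unique xs!)))
  where
  fresh : ∀ {p} → p ∈ perms xs → x ∉ p
  fresh p∈ x∈p = All.lookup x∉ (∈-resp-↭ (perms-↭ xs p∈) x∈p) refl

  disjoint : ∀ {ps} → (∀ {p} → p ∈ ps → p ∈ perms xs) → Unique ps →
    AllPairs (λ p q → Disjoint (insertions x p) (insertions x q)) ps
  disjoint ⊆perms [] = []
  disjoint ⊆perms (p∉ ∷ ps!) =
    All.tabulate (λ q∈ (z∈p , z∈q) → All.lookup p∉ q∈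
      (trans (sym (insertions-delete _ (fresh (⊆perms (here refl))) z∈p))
          (insertions-delete _ (fresh (⊆perms (there q∈))) z∈q)))
    ∷ disjoint (⊆perms ∘ there) ps!

oneTo-unique : ∀ n → Unique (oneTo n)
oneTo-unique n = Uniqueₚ.map⁺ suc-injective (Uniqueₚ.upTo⁺ n)

Sym-unique : ∀ n → Unique (Sym n)
Sym-unique n = perms-unique (oneTo-unique n)

Sym-length : ∀ n {σ} → σ ∈ Sym n → length σ ≡ n
Sym-length n σ∈ = trans (↭-length (perms-↭ (oneTo n) σ∈)) (length-oneTo n)

stdInverse-∈ : ∀ w → stdInverse w ∈ Sym (length w)
stdInverse-∈ w = ∈-perms _ (stdInverse-↭ w)

map-≡⇒pointwise : ∀ {A B : Set} {f g : A → B} xs → map f xs ≡ map g xs → ∀ {x} → x ∈ xs → f x ≡ g x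
map-≡⇒pointwise (x ∷ xs) eq (here refl) = ∷-injectiveˡ eq
map-≡⇒pointwise (x ∷ xs) eq (there x∈) = map-≡⇒pointwise xs (∷-injectiveʳ eq) x∈

pos-∈ : ∀ {x w} → x ∈ w → pos x w ≢ 0
pos-∈ {x} {y ∷ w} _ with y ≟ x
... | yes _ = λ ()
... | no  _ = λ ()

-- The heads must agree: the first letter of one word has position 1 there, hence also in the other
-- word.
pos-injective : ∀ {s t} → Unique s → length s ≡ length t → (∀ {k} → k ∈ s → k ∈ t × pos k s ≡ pos k t) → s ≡ t
pos-injective {[]} {[]} _ _ _ = refl
pos-injective {a ∷ s} {b ∷ t} (a∉ ∷ s!) len same with b ≟ a
... | no b≢a = case same (here refl) of λ
  { (here a≡b , _) → contradiction (sym a≡b) b≢a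
  ; (there a∈t , eq) → contradiction (sym (suc-injective
      (trans (sym (pos-here a s)) (trans eq (pos-there t b≢a))))) (pos-∈ a∈t) }
... | yes refl = cong (a ∷_) (pos-injective s! (suc-injective len) same′)
  where
  same′ : ∀ {k} → k ∈ s → k ∈ t × pos k s ≡ pos k t
  same′ k∈ with same (there k∈)
  ... | here refl , _ = contradiction refl (All.lookup a∉ k∈)
  ... | there k∈t , eq = k∈t , suc-injective (trans (sym (pos-there s (All.lookup a∉ k∈)))
      (trans eq (pos-there t (All.lookup a∉ k∈))))

inverse-injective : ∀ n {σ τ} → σ ∈ Sym n → τ ∈ Sym n → inverse σ ≡ inverse τ → σ ≡ τ
inverse-injective n {σ} {τ} σ∈ τ∈ eq = pos-injective
    (Permₛ.Unique-resp-↭ (setoid ℕ) (↭⇒↭ₛ (↭-sym σ↭)) (oneTo-unique n))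
  (trans (Sym-length n σ∈) (sym (Sym-length n τ∈)))
  (λ k∈ → ∈-resp-↭ (↭-sym τ↭) (∈-resp-↭ σ↭ k∈) , map-≡⇒pointwise (oneTo n) eq′ (∈-resp-↭ σ↭ k∈))
  where
  σ↭ = perms-↭ (oneTo n) σ∈
  τ↭ = perms-↭ (oneTo n) τ∈
  eq′ : map (λ k → pos k σ) (oneTo n) ≡ map (λ k → pos k τ) (oneTo n)
  eq′ = subst (λ m → map (λ k → pos k σ) (oneTo n) ≡ map (λ k → pos k τ) (oneTo m)) (Sym-length n τ∈)
       (subst (λ m → map (λ k → pos k σ) (oneTo m) ≡ map (λ k → pos k τ) (oneTo (length τ)))
           (Sym-length n σ∈) eq)

-- At a given `w` this leaves a single `σ` for which `F σ` can be nonzero. The size comes from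
-- comparing the lengths of both sides of the hypothesis.
stdInverse-unique : ∀ n {σ} w → σ ∈ Sym n → std w ≡ inverse σ → σ ≡ stdInverse w × length w ≡ n
stdInverse-unique n {σ} w σ∈ eq = inverse-injective n σ∈
    (subst (λ m → stdInverse w ∈ Sym m) len (stdInverse-∈ w)) (trans (sym eq) (inverse-stdInverse w)) , len
  where
  len : length w ≡ n
  len = trans (sym (length-std w)) (trans (cong length eq)
      (trans (length-map (λ k → pos k σ) (oneTo (length σ)))
      (trans (length-oneTo (length σ)) (Sym-length n σ∈))))

-- Cutting trees

-- The shape of the decreasing tree of a prefix, resp. suffix, depends only on that of the word.
takeTree : ℕ → Tree → Tree
takeTree n leaf = leaf
takeTree n (node l r) with n ≤? size l
... | yes _ = takeTree n l
... | no  _ = node l (takeTree (n ∸ suc (size l)) r)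

dropTree : ℕ → Tree → Tree
dropTree n leaf = leaf
dropTree n (node l r) with n ≤? size l
... | yes _ = node (dropTree n l) r
... | no  _ = dropTree (n ∸ suc (size l)) r

take-++-≤ : ∀ {A : Set} n (u v : List A) → n ≤ length u → take n (u ++ v) ≡ take n u
take-++-≤ zero u v _ = refl
take-++-≤ (suc n) (x ∷ u) v (s≤s p) = cong (x ∷_) (take-++-≤ n u v p)

drop-++-≤ : ∀ {A : Set} n (u v : List A) → n ≤ length u → drop n (u ++ v) ≡ drop n u ++ v
drop-++-≤ zero u v _ = refl
drop-++-≤ (suc n) (x ∷ u) v (s≤s p) = drop-++-≤ n u v p

take-++-> : ∀ {A : Set} n (u : List A) m v → length u < n →
  take n (u ++ m ∷ v) ≡ u ++ m ∷ take (n ∸ suc (length u)) v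
take-++-> (suc n) [] m v _ = refl
take-++-> (suc n) (x ∷ u) m v (s≤s p) = cong (x ∷_) (take-++-> n u m v p)

drop-++-> : ∀ {A : Set} n (u : List A) m v → length u < n → drop n (u ++ m ∷ v) ≡ drop (n ∸ suc (length u)) v
drop-++-> (suc n) [] m v _ = refl
drop-++-> (suc n) (x ∷ u) m v (s≤s p) = drop-++-> n u m v p

-- If the prefix contains the rightmost maximum, that letter stays the root; otherwise the prefix
-- lies in the left part.
≻-take : ∀ n {w T} → w ≻ T → take n w ≻ takeTree n T
≻-take zero empty = empty
≻-take (suc n) empty = empty
≻-take n (split {u} {m} {v} {l} u≤m v<m u≻l v≻r) with n ≤? size l
... | yes n≤l rewrite take-++-≤ n u (m ∷ v) (≤-trans n≤l (≤-reflexive (sym (≻-size u≻l)))) = ≻-take n u≻l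
... | no  n≰l rewrite take-++-> n u m v (≤-<-trans (≤-reflexive (≻-size u≻l)) (≰⇒> n≰l)) | ≻-size u≻l =
  split u≤m (Allₚ.take⁺ (n ∸ suc (size l)) v<m) u≻l (≻-take (n ∸ suc (size l)) v≻r)

≻-drop : ∀ n {w T} → w ≻ T → drop n w ≻ dropTree n T
≻-drop zero empty = empty
≻-drop (suc n) empty = empty
≻-drop n (split {u} {m} {v} {l} u≤m v<m u≻l v≻r) with n ≤? size l
... | yes n≤l rewrite drop-++-≤ n u (m ∷ v) (≤-trans n≤l (≤-reflexive (sym (≻-size u≻l)))) =
  split (Allₚ.drop⁺ n u≤m) v<m (≻-drop n u≻l) v≻r
... | no  n≰l rewrite drop-++-> n u m v (≤-<-trans (≤-reflexive (≻-size u≻l)) (≰⇒> n≰l)) | ≻-size u≻l =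
  ≻-drop (n ∸ suc (size l)) v≻r

takeTree-0 : ∀ T → takeTree 0 T ≡ leaf
takeTree-0 leaf = refl
takeTree-0 (node l r) = takeTree-0 l

dropTree-0 : ∀ T → dropTree 0 T ≡ T
dropTree-0 leaf = refl
dropTree-0 (node l r) = cong (λ l′ → node l′ r) (dropTree-0 l)

takeTree-root : ∀ l r → takeTree (suc (size l)) (node l r) ≡ node l leaf
takeTree-root l r with suc (size l) ≤? size l
... | yes p = contradiction p (n≮n (size l))
... | no  _ rewrite n∸n≡0 (size l) = cong (node l) (takeTree-0 r)

dropTree-root : ∀ l r → dropTree (suc (size l)) (node l r) ≡ r
dropTree-root l r with suc (size l) ≤? size l
... | yes p = contradiction p (n≮n (size l))
... | no  _ rewrite n∸n≡0 (size l) = dropTree-0 r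

-- Each node is labelled by the size of its subtree, so a root exceeds all letters below it. These
-- words realise every shape, so that a series can be tested at any chosen tree.
treeWord : Tree → Word
treeWord leaf = []
treeWord T@(node l r) = treeWord l ++ size T ∷ treeWord r

treeWord-≤ : ∀ T → All (_≤ size T) (treeWord T)
treeWord-≤ leaf = []
treeWord-≤ (node l r) = Allₚ.++⁺ (All.map (λ p → m≤n⇒m≤1+n (≤-trans p (m≤m+n (size l) (size r))))
    (treeWord-≤ l))
  (≤-refl ∷ All.map (λ p → m≤n⇒m≤1+n (≤-trans p (m≤n+m (size r) (size l)))) (treeWord-≤ r))

treeWord-≻ : ∀ T → treeWord T ≻ T
treeWord-≻ leaf = empty
treeWord-≻ (node l r) = split (All.map (λ p → m≤n⇒m≤1+n (≤-trans p (m≤m+n (size l) (size r)))) (treeWord-≤ l))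
  (All.map (λ p → s≤s (≤-trans p (m≤n+m (size r) (size l)))) (treeWord-≤ r))
  (treeWord-≻ l) (treeWord-≻ r)

-- The triangularity order

-- The number of inversions of wT T (see inv-canonicalWord).
treeInv : Tree → ℕ
treeInv leaf = 0
treeInv (node l r) = treeInv l + treeInv r + size r * suc (size l)

-- A coarse stand-in for the weak order on canonical words, comparing only inversion numbers at
-- equal size. Equality is a separate case because it carries the diagonal coefficient.
_⊴_ : Tree → Tree → Set
S ⊴ T = size S ≡ size T × (S ≡ T ⊎ treeInv S < treeInv T)

⊴-refl : ∀ {T} → T ⊴ T
⊴-refl = refl , inj₁ refl

⊴-trans : ∀ {R S T} → R ⊴ S → S ⊴ T → R ⊴ T
⊴-trans (s , inj₁ refl) q = q
⊴-trans p@(_ , inj₂ _) (_ , inj₁ refl) = p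
⊴-trans (s , inj₂ p) (t , inj₂ q) = trans s t , inj₂ (<-trans p q)

⊴⇒treeInv-≤ : ∀ {S T} → S ⊴ T → treeInv S ≤ treeInv T
⊴⇒treeInv-≤ (_ , inj₁ refl) = ≤-refl
⊴⇒treeInv-≤ (_ , inj₂ p) = <⇒≤ p

-- The sizes agree, so the product term of `treeInv` is the same on both sides and only the
-- inversions of the subtrees matter.
⊴-node : ∀ {l l′ r r′} → l ⊴ l′ → r ⊴ r′ → node l r ⊴ node l′ r′
⊴-node {l} {l′} {r} {r′} p@(sl , l≤) q@(sr , r≤) = cong suc (cong₂ _+_ sl sr) , go l≤ r≤
  where
  go : l ≡ l′ ⊎ treeInv l < treeInv l′ → r ≡ r′ ⊎ treeInv r < treeInv r′ →
    node l r ≡ node l′ r′ ⊎ treeInv (node l r) < treeInv (node l′ r′)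
  go (inj₁ refl) (inj₁ refl) = inj₁ refl
  go (inj₂ l<) _ rewrite sl | sr = inj₂ (+-monoˡ-< _ (+-mono-<-≤ l< (⊴⇒treeInv-≤ q)))
  go (inj₁ refl) (inj₂ r<) rewrite sr = inj₂ (+-monoˡ-< _ (+-monoʳ-< (treeInv l) r<))

⊴-node-leaf⁻ : ∀ {l l′} → node l leaf ⊴ node l′ leaf → l ⊴ l′
⊴-node-leaf⁻ {l} {l′} (s , p) = +-cancelʳ-≡ 0 (size l) (size l′) (suc-injective s) , go p
  where
  go : node l leaf ≡ node l′ leaf ⊎ treeInv (node l leaf) < treeInv (node l′ leaf) →
      l ≡ l′ ⊎ treeInv l < treeInv l′
  go (inj₁ refl) = inj₁ refl
  go (inj₂ q) rewrite +-identityʳ (treeInv l + 0) | +-identityʳ (treeInv l) | +-identityʳ (treeInv l′ + 0)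
      | +-identityʳ (treeInv l′) = inj₂ q

-- Rotating l below the root loses size l + 1 inversions.
treeInv-rotate : ∀ l a b → treeInv (node l (node a b)) ≡ suc (size l) + treeInv (node (node l a) b)
treeInv-rotate l a b = solve 6 (λ il ia ib sl sa sb →
    il :+ (ia :+ ib :+ sb :* (con 1 :+ sa)) :+ (con 1 :+ (sa :+ sb)) :* (con 1 :+ sl)
    := (con 1 :+ sl) :+ (((il :+ ia) :+ sa :* (con 1 :+ sl)) :+ ib :+ sb :* (con 1 :+ (con 1 :+ (sl :+ sa)))))
  refl (treeInv l) (treeInv a) (treeInv b) (size l) (size a) (size b)
  where open +-*-Solver

-- If the cut falls inside the left subtree `a`, induction bounds `a` by `node l d`, and rotating
-- `node (node l d) b` into `node l (node d b)` adds `suc (size l)` inversions. Otherwise the root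
-- is kept, which forces `a` to be `l`, and the tree already has the required form. This makes
-- products triangular.
⊴-cut : ∀ l S → takeTree (suc (size l)) S ≡ node l leaf → S ⊴ node l (dropTree (suc (size l)) S)
⊴-cut l (node a b) eq with suc (size l) ≤? size a
... | yes _ = ⊴-trans (⊴-node (⊴-cut l a eq) (⊴-refl {b}))
  (cong suc (trans (+-assoc (suc (size l)) (size d) (size b)) (sym (+-suc (size l) (size d + size b)))) ,
   inj₂ (subst (treeInv (node (node l d) b) <_) (sym (treeInv-rotate l d b)) (s≤s (m≤n+m _ (size l)))))
  where d = dropTree (suc (size l)) a
... | no _ with refl ← node-injˡ eq rewrite n∸n≡0 (size a) = subst (λ d → node a b ⊴ node a d)
    (sym (dropTree-0 b)) ⊴-refl

-- The weak order

inv : Word → ℕ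
inv [] = 0
inv (x ∷ w) = countLt x w + inv w

WStep⇒↭ : ∀ {u v} → WStep u v → u ↭ v
WStep⇒↭ (here rest _) = swap _ _ ↭-refl
WStep⇒↭ (there s) = prep _ (WStep⇒↭ s)

-- The exchanged pair becomes an inversion, and every other pair contributes as before.
inv-WStep : ∀ {u v} → WStep u v → inv v ≡ suc (inv u)
inv-WStep (here {a} {b} w a<b) rewrite countLt-accept w a<b | countLt-reject w (<⇒≤ a<b) =
  cong suc (x∙yz≈y∙xz (countLt b w) (countLt a w) (inv w))
inv-WStep (there {x} {u} {v} s) rewrite countLt-↭ x (WStep⇒↭ s) | inv-WStep s = +-suc (countLt x v) (inv u)

inv-≤W : ∀ {u v} → u ≤W v → u ≡ v ⊎ inv u < inv v
inv-≤W ε = inj₁ refl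
inv-≤W (s ◅ p) with inv-≤W p
... | inj₁ refl = inj₂ (≤-reflexive (sym (inv-WStep s)))
... | inj₂ q = inj₂ (<-trans (≤-reflexive (sym (inv-WStep s))) q)

lastLetter : Word → ℕ
lastLetter [] = 0
lastLetter (x ∷ []) = x
lastLetter (x ∷ y ∷ w) = lastLetter (y ∷ w)

lastLetter-∷ʳ : ∀ w x → lastLetter (w ∷ʳ x) ≡ x
lastLetter-∷ʳ [] x = refl
lastLetter-∷ʳ (y ∷ []) x = refl
lastLetter-∷ʳ (y ∷ z ∷ w) x = lastLetter-∷ʳ (z ∷ w) x

-- Only an exchange of the final two letters affects the end of the word, and it puts the smaller
-- one there.
lastLetter-WStep : ∀ {u v} → WStep u v → lastLetter v ≤ lastLetter u
lastLetter-WStep (here [] a<b) = <⇒≤ a<b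
lastLetter-WStep (here (_ ∷ []) _) = ≤-refl
lastLetter-WStep (here (_ ∷ _ ∷ _) _) = ≤-refl
lastLetter-WStep (there s@(here _ _)) = lastLetter-WStep s
lastLetter-WStep (there s@(there (here _ _))) = lastLetter-WStep s
lastLetter-WStep (there s@(there (there _))) = lastLetter-WStep s

lastLetter-≤W : ∀ {u v} → u ≤W v → lastLetter v ≤ lastLetter u
lastLetter-≤W ε = ≤-refl
lastLetter-≤W (s ◅ p) = ≤-trans (lastLetter-≤W p) (lastLetter-WStep s)

-- Canonical words: letters, inversions, injectivity

canonicalWord : ℕ → Tree → Word
canonicalWord k T = rpostfix (labelFrom k T)

length-canonicalWord : ∀ k T → length (canonicalWord k T) ≡ size T
length-canonicalWord k leaf = refl
length-canonicalWord k (node l r)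
  rewrite length-++ (canonicalWord (suc (k + size l)) r) {canonicalWord k l ∷ʳ suc (k + size l)}
        | length-++ (canonicalWord k l) {suc (k + size l) ∷ []}
        | length-canonicalWord (suc (k + size l)) r | length-canonicalWord k l =
  trans (cong (size r +_) (+-comm (size l) 1))
      (trans (+-suc (size r) (size l)) (cong suc (+-comm (size r) (size l))))

canonicalWord-lower : ∀ k T → All (k <_) (canonicalWord k T)
canonicalWord-lower k leaf = []
canonicalWord-lower k (node l r) = Allₚ.++⁺
  (All.map (≤-trans (s≤s (m≤n⇒m≤1+n (m≤m+n k (size l))))) (canonicalWord-lower (suc (k + size l)) r))
  (Allₚ.++⁺ (canonicalWord-lower k l) (s≤s (m≤m+n k (size l)) ∷ []))

canonicalWord-upper : ∀ k T → All (_≤ k + size T) (canonicalWord k T)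
canonicalWord-upper k leaf = []
canonicalWord-upper k (node l r) = Allₚ.++⁺
  (All.map (λ p → ≤-trans p (≤-reflexive (trans (cong suc (+-assoc k (size l) (size r)))
      (sym (+-suc k (size l + size r)))))) (canonicalWord-upper (suc (k + size l)) r))
  (Allₚ.++⁺ (All.map (λ p → ≤-trans p (+-monoʳ-≤ k (m≤n⇒m≤1+n (m≤m+n (size l) (size r)))))
      (canonicalWord-upper k l))
    (≤-trans (≤-reflexive (sym (+-suc k (size l)))) (+-monoʳ-≤ k (s≤s (m≤m+n (size l) (size r)))) ∷ []))

countLt-++ : ∀ x u v → countLt x (u ++ v) ≡ countLt x u + countLt x v
countLt-++ x [] v = refl
countLt-++ x (y ∷ u) v rewrite countLt-∷ x y (u ++ v) | countLt-∷ x y u | countLt-++ x u v =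
  sym (+-assoc (countLt x (y ∷ [])) _ _)

countLt-all : ∀ {x w} → All (_< x) w → countLt x w ≡ length w
countLt-all [] = refl
countLt-all (y<x ∷ p) = trans (countLt-accept _ y<x) (cong suc (countLt-all p))

inv-++ : ∀ {u v} → All (λ x → All (_< x) v) u → inv (u ++ v) ≡ inv u + inv v + length u * length v
inv-++ {[]} {v} [] = sym (+-identityʳ (inv v))
inv-++ {x ∷ u} {v} (v<x ∷ p) rewrite countLt-++ x u v | countLt-all v<x | inv-++ p =
  solve 5 (λ c n i j m → (c :+ n) :+ (i :+ j :+ m) := (c :+ i) :+ j :+ (n :+ m)) refl
    (countLt x u) (length v) (inv u) (inv v) (length u * length v)
  where open +-*-Solver

inv-∷ʳ : ∀ {u m} → All (_≤ m) u → inv (u ∷ʳ m) ≡ inv u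
inv-∷ʳ [] = refl
inv-∷ʳ {x ∷ u} {m} (x≤m ∷ p) rewrite countLt-++ x u (m ∷ []) | countLt-none (x≤m ∷ []) | +-identityʳ (countLt x u) =
  cong (countLt x u +_) (inv-∷ʳ p)

-- Every letter of `R` exceeds `m` and the letters of `L`, which gives the product term; `m` bounds
-- `L` and stands last, so it adds nothing.
inv-canonicalWord : ∀ k T → inv (canonicalWord k T) ≡ treeInv T
inv-canonicalWord k leaf = refl
inv-canonicalWord k (node l r) = begin
  inv (R ++ L ∷ʳ m)                                    ≡⟨ inv-++
      (All.map (λ m<x → All.map (λ y≤m → ≤-<-trans y≤m m<x) L∷ʳm≤m) (canonicalWord-lower m r)) ⟩
  inv R + inv (L ∷ʳ m) + length R * length (L ∷ʳ m)    ≡⟨ cong₂ (λ i n → inv R + i + n) (inv-∷ʳ L≤m)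
      (cong (length R *_) (trans (length-++ L) (+-comm (length L) 1))) ⟩
  inv R + inv L + length R * suc (length L)            ≡⟨ cong₂ (λ i n → i + n)
      (trans (+-comm (inv R) (inv L)) (cong₂ _+_ (inv-canonicalWord k l) (inv-canonicalWord m r)))
      (cong₂ (λ a b → a * suc b) (length-canonicalWord m r) (length-canonicalWord k l)) ⟩
  treeInv (node l r)                                   ∎
  where
  open ≡-Reasoning
  m = suc (k + size l)
  R = canonicalWord m r
  L = canonicalWord k l
  L≤m : All (_≤ m) L
  L≤m = All.map m≤n⇒m≤1+n (canonicalWord-upper k l)
  L∷ʳm≤m : All (_≤ m) (L ∷ʳ m)
  L∷ʳm≤m = Allₚ.++⁺ L≤m (≤-refl ∷ [])

++-injective : ∀ {A : Set} (a c : List A) {b d} → length a ≡ length c → a ++ b ≡ c ++ d → a ≡ c × b ≡ d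
++-injective [] [] _ eq = refl , eq
++-injective (x ∷ a) (y ∷ c) len eq with ++-injective a c (suc-injective len) (∷-injectiveʳ eq)
... | a≡c , b≡d = cong₂ _∷_ (∷-injectiveˡ eq) a≡c , b≡d

-- The last letter determines `size l` and the length then determines `size r`, so both words are
-- cut at the same places.
canonicalWord-injective : ∀ k S T → canonicalWord k S ≡ canonicalWord k T → S ≡ T
canonicalWord-injective k leaf leaf _ = refl
canonicalWord-injective k leaf T@(node _ _) eq = contradiction
    (trans (cong length eq) (length-canonicalWord k T)) λ ()
canonicalWord-injective k S@(node _ _) leaf eq = contradiction
    (trans (sym (cong length eq)) (length-canonicalWord k S)) λ ()
canonicalWord-injective k S@(node l r) T@(node l′ r′) eq = cong₂ node
  (canonicalWord-injective k l l′ (proj₂ parts))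
  (canonicalWord-injective m r r′ (trans (proj₁ parts) (cong (λ n → canonicalWord n r′) (sym (proj₂ ends)))))
  where
  m = suc (k + size l)
  m′ = suc (k + size l′)
  ends = ∷ʳ-injective (canonicalWord m r ++ canonicalWord k l) (canonicalWord m′ r′ ++ canonicalWord k l′)
    (trans (++-assoc (canonicalWord m r) _ _) (trans eq (sym (++-assoc (canonicalWord m′ r′) _ _))))
  size-l : size l ≡ size l′
  size-l = +-cancelˡ-≡ k _ _ (suc-injective (proj₂ ends))
  size-r : size r ≡ size r′
  size-r = +-cancelˡ-≡ (size l) _ _ (trans (suc-injective
      (trans (sym (length-canonicalWord k S)) (trans (cong length eq) (length-canonicalWord k T))))
      (cong (_+ size r′) (sym size-l)))
  parts = ++-injective (canonicalWord m r) (canonicalWord m′ r′)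
    (trans (length-canonicalWord m r) (trans size-r (sym (length-canonicalWord m′ r′)))) (proj₁ ends)

≤W⇒⊴ : ∀ {S T} → size S ≡ size T → wT S ≤W wT T → S ⊴ T
≤W⇒⊴ {S} {T} s p with inv-≤W p
... | inj₁ eq = s , inj₁ (canonicalWord-injective 0 S T eq)
... | inj₂ q rewrite inv-canonicalWord 0 S | inv-canonicalWord 0 T = s , inj₂ q

lastLetter-wT : ∀ l r → lastLetter (wT (node l r)) ≡ suc (size l)
lastLetter-wT l r = trans (cong lastLetter
    (sym (++-assoc (canonicalWord (suc (size l)) r) (canonicalWord 0 l) _)))
  (lastLetter-∷ʳ (canonicalWord (suc (size l)) r ++ canonicalWord 0 l) _)

-- The last letter of wT T is the root label, which is maximal iff the root has no right child.
≤W-RootNoRight : ∀ {S T} → size S ≡ size T → wT S ≤W wT T → RootNoRight T → RootNoRight S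
≤W-RootNoRight {node l leaf} {node l′ leaf} _ _ _ = tt
≤W-RootNoRight {node l r@(node _ _)} {node l′ leaf} s p _ = contradiction (begin-strict
    size l′           ≤⟨ s≤s⁻¹ (subst₂ _≤_ (lastLetter-wT l′ leaf) (lastLetter-wT l r) (lastLetter-≤W p)) ⟩
    size l            <⟨ m<m+n (size l) (s≤s z≤n) ⟩
    size l + size r   ≡⟨ suc-injective s ⟩
    size l′ + 0       ≡⟨ +-identityʳ (size l′) ⟩
    size l′           ∎) (n≮n (size l′))
  where open ≤-Reasoning

-- Enumeration of trees

∈-treesH : ∀ h T → size T ≤ h → T ∈ treesH h
∈-treesH zero leaf _ = here refl
∈-treesH (suc h) leaf _ = here refl
∈-treesH (suc h) (node l r) (s≤s p) = there
    (∈-concatMap⁺ _ (lose (∈-treesH h l (≤-trans (m≤m+n (size l) (size r)) p))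
  (∈-map⁺ (node l) (∈-treesH h r (≤-trans (m≤n+m (size r) (size l)) p)))))

treesH-unique : ∀ h → Unique (treesH h)
treesH-unique zero = [] ∷ []
treesH-unique (suc h) = All.tabulate leaf∉ ∷ Uniqueₚ.concat⁺
  (Allₚ.map⁺ (All.universal (λ l → Uniqueₚ.map⁺ node-injʳ (treesH-unique h)) (treesH h)))
  (AllPairsₚ.map⁺ (AllPairs.map (λ l≢l′ {_} (p , q) → l≢l′ (disjoint p q)) (treesH-unique h)))
  where
  leaf∉ : ∀ {T} → T ∈ concatMap (λ l → map (node l) (treesH h)) (treesH h) → leaf ≢ T
  leaf∉ T∈ refl with find (∈-concatMap⁻ (λ l → map (node l) (treesH h)) {xs = treesH h} T∈)
  ... | l , _ , q with ∈-map⁻ (node l) q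
  ... | _ , _ , ()
  disjoint : ∀ {l l′ T} → T ∈ map (node l) (treesH h) → T ∈ map (node l′) (treesH h) → l ≡ l′
  disjoint p q with ∈-map⁻ _ p | ∈-map⁻ _ q
  ... | _ , _ , refl | _ , _ , refl = refl

treesOfSize-unique : ∀ n → Unique (treesOfSize n)
treesOfSize-unique n = Uniqueₚ.filter⁺ (λ T → size T ≟ n) (treesH-unique n)

∈-treesOfSize : ∀ {n} T → size T ≡ n → T ∈ treesOfSize n
∈-treesOfSize {n} T s = ∈-filter⁺ (λ T → size T ≟ n) (∈-treesH n T (≤-reflexive s)) s

treesOfSize-size : ∀ n {T} → T ∈ treesOfSize n → size T ≡ n
treesOfSize-size n T∈ = proj₂ (∈-filter⁻ (λ T → size T ≟ n) {xs = treesH n} T∈)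

-- Right combs

-- Each factor whose root has no right child receives the comb of the later factors as right
-- subtree. On such lists `generators`, which cuts the right branch, is the inverse.
comb : List Tree → Tree
comb [] = leaf
comb (leaf ∷ ts) = comb ts
comb (node l _ ∷ ts) = node l (comb ts)

generators : Tree → List Tree
generators leaf = []
generators (node l r) = node l leaf ∷ generators r

generators-RootNoRight : ∀ T → All RootNoRight (generators T)
generators-RootNoRight leaf = []
generators-RootNoRight (node l r) = tt ∷ generators-RootNoRight r

comb-generators : ∀ T → comb (generators T) ≡ T
comb-generators leaf = refl
comb-generators (node l r) = cong (node l) (comb-generators r)

generators-comb : ∀ {ts} → All RootNoRight ts → generators (comb ts) ≡ ts
generators-comb [] = refl
generators-comb {node l leaf ∷ ts} (_ ∷ p) = cong (node l leaf ∷_) (generators-comb p)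

-- Expansions of series

-- The sum of all values serves as the bound; it starts the downward induction of
-- `coefficients-zero`.
bound : ∀ {a} {A : Set a} (f : A → ℕ) xs → ∃ λ b → ∀ {x} → x ∈ xs → f x ≤ b
bound f [] = 0 , λ ()
bound f (x ∷ xs) with bound f xs
... | b , f≤b = f x + b , λ { (here refl) → m≤m+n (f x) b ; (there y∈) → ≤-trans (f≤b y∈) (m≤n+m b (f x)) }

module PBT {c ℓ : Level} (K : CommutativeRing c ℓ) where
  open CommutativeRing K using (Carrier; _≈_; 0#; 1#; +-cong; +-congˡ; *-cong; *-congˡ; *-congʳ; -‿cong; -‿inverseʳ)
    renaming (_+_ to _⊕_; _*_ to _⊗_; -_ to ⊖_; refl to ≈-refl; sym to ≈-sym; trans to ≈-trans;
              reflexive to ≈-reflexive; zeroˡ to ⊗-zeroˡ; zeroʳ to ⊗-zeroʳ; distribˡ to ⊗-distribˡ-⊕;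
              +-identityˡ to ⊕-identityˡ; +-identityʳ to ⊕-identityʳ; +-assoc to ⊕-assoc;
              *-identityˡ to ⊗-identityˡ; *-identityʳ to ⊗-identityʳ; *-assoc to ⊗-assoc)
  open Series K

  sum-cong : ∀ {a} {A : Set a} {f g : A → Carrier} xs → (∀ x → f x ≈ g x) → sumK (map f xs) ≈ sumK (map g xs)
  sum-cong [] f≈g = ≈-refl
  sum-cong (x ∷ xs) f≈g = +-cong (f≈g x) (sum-cong xs f≈g)

  sum-zero : ∀ {a} {A : Set a} {f : A → Carrier} xs → (∀ {x} → x ∈ xs → f x ≈ 0#) → sumK (map f xs) ≈ 0#
  sum-zero [] _ = ≈-refl
  sum-zero (x ∷ xs) f≈0 = ≈-trans (+-cong (f≈0 (here refl)) (sum-zero xs (f≈0 ∘ there))) (⊕-identityˡ 0#)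

  -- Distinctness goes through `key` to cover lists of pairs of a coefficient and a monomial, where
  -- the monomials alone are known to be distinct.
  sum-single : ∀ {a b} {A : Set a} {B : Set b} (key : A → B) (f : A → Carrier) {xs y} →
    AllPairs (λ x z → key x ≢ key z) xs → y ∈ xs →
    (∀ {x} → x ∈ xs → key x ≢ key y → f x ≈ 0#) → sumK (map f xs) ≈ f y
  sum-single key f {x ∷ xs} (x≢ ∷ _) (here refl) f≈0 =
    ≈-trans (+-congˡ (sum-zero xs (λ z∈ → f≈0 (there z∈) (≢-sym (All.lookup x≢ z∈))))) (⊕-identityʳ (f x))
  sum-single key f {x ∷ xs} (x≢ ∷ xs!) (there y∈) f≈0 =
    ≈-trans (+-cong (f≈0 (here refl) (All.lookup x≢ y∈)) (sum-single key f xs! y∈ (f≈0 ∘ there)))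
        (⊕-identityˡ _)

  sumS-apply : ∀ {a} {A : Set a} (h : A → Ser) xs w → sumS (map h xs) w ≡ sumK (map (λ x → h x w) xs)
  sumS-apply h [] w = refl
  sumS-apply h (x ∷ xs) w = cong (h x w ⊕_) (sumS-apply h xs w)

  lin-apply : ∀ {a} {A : Set a} (h : A → Ser) cs w →
    lin (map (λ p → proj₁ p , h (proj₂ p)) cs) w ≡ sumK (map (λ p → proj₁ p ⊗ h (proj₂ p) w) cs)
  lin-apply h [] w = refl
  lin-apply h (p ∷ cs) w = cong (proj₁ p ⊗ h (proj₂ p) w ⊕_) (lin-apply h cs w)

  δ : Tree → Tree → Carrier
  δ S T with S ≟T T
  ... | yes _ = 1#
  ... | no  _ = 0#

  δ-refl : ∀ T → δ T T ≈ 1#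
  δ-refl T with T ≟T T
  ... | yes _ = ≈-refl
  ... | no ¬p = contradiction refl ¬p

  δ-≢ : ∀ S T → S ≢ T → δ S T ≈ 0#
  δ-≢ S T S≢T with S ≟T T
  ... | yes p = contradiction p S≢T
  ... | no _ = ≈-refl

  F-std : ∀ {σ w} → std w ≡ inverse σ → F σ w ≈ 1#
  F-std {σ} {w} eq with listEq? (std w) (inverse σ)
  ... | yes _ = ≈-refl
  ... | no ¬p = contradiction eq ¬p

  F-≢ : ∀ {σ w} → std w ≢ inverse σ → F σ w ≈ 0#
  F-≢ {σ} {w} neq with listEq? (std w) (inverse σ)
  ... | yes p = contradiction p neq
  ... | no _ = ≈-refl

  -- At `w` only the term of `stdInverse w` survives, and it occurs exactly when its binary search
  -- tree has shape `T`. So the `P T` are indicator series of disjoint sets of words.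
  P-δ : ∀ T w → P T w ≈ δ T (decreasingTree w)
  P-δ T w = ≈-trans (≈-reflexive (sumS-apply F σs w)) sum≈
    where
    hasShape? = λ σ → shape (bst σ) ≟T T
    σs = filter hasShape? (Sym (size T))

    std≢ : ∀ {σ} → σ ∈ σs → σ ≢ stdInverse w → F σ w ≈ 0#
    std≢ σ∈ σ≢ = F-≢ (λ eq → σ≢ (proj₁ (stdInverse-unique (size T) w (proj₁ (∈-filter⁻ hasShape? σ∈)) eq)))

    sum≈ : sumK (map (λ σ → F σ w) σs) ≈ δ T (decreasingTree w)
    sum≈ with T ≟T decreasingTree w
    ... | yes T≡ = ≈-trans (sum-single id (λ σ → F σ w)
        (Uniqueₚ.filter⁺ hasShape? (Sym-unique (size T))) stdInverse∈ std≢)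
                           (F-std (inverse-stdInverse w))
      where
      stdInverse∈ : stdInverse w ∈ σs
      stdInverse∈ = ∈-filter⁺ hasShape?
        (subst (λ n → stdInverse w ∈ Sym n) (trans (≻-size (≻-decreasingTree w)) (cong size (sym T≡)))
            (stdInverse-∈ w))
        (sym T≡)
    ... | no  T≢ = sum-zero σs (λ σ∈ → std≢ σ∈
        (λ { refl → T≢ (sym (proj₂ (∈-filter⁻ hasShape? {xs = Sym (size T)} σ∈))) }))

  -- A cut at any other place kills the first factor. When `w` is shorter than `n`, so is
  -- `take n w`, and both sides vanish.
  *S-homogeneous : ∀ n (f h : Ser) → (∀ u → length u ≢ n → f u ≈ 0#) → ∀ w →
    (f *S h) w ≈ f (take n w) ⊗ h (drop n w)
  *S-homogeneous n f h f≈0 w with n ≤? length w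
  ... | yes n≤w = sum-single id (λ k → f (take k w) ⊗ h (drop k w)) (Uniqueₚ.upTo⁺ (suc (length w)))
      (∈-upTo⁺ (s≤s n≤w))
        (λ {k} k∈ k≢n → ≈-trans (*-congʳ (f≈0 (take k w)
          (λ eq → k≢n (trans (sym (m≤n⇒m⊓n≡m (s≤s⁻¹ (∈-upTo⁻ k∈)))) (trans (sym (length-take k w)) eq)))))
              (⊗-zeroˡ _))
  ... | no n≰w = ≈-trans
        (sum-zero (upTo (suc (length w))) (λ {k} _ → ≈-trans (*-congʳ (short k)) (⊗-zeroˡ _)))
        (≈-sym (≈-trans (*-congʳ (short n)) (⊗-zeroˡ _)))
    where
    short : ∀ k → f (take k w) ≈ 0#
    short k = f≈0 (take k w) (λ eq → n≰w
        (≤-trans (≤-reflexive (trans (sym eq) (length-take k w))) (m⊓n≤n k (length w))))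

  sum-P : ∀ (a : Tree → Carrier) {Ts} w → Unique Ts → decreasingTree w ∈ Ts →
    sumK (map (λ S → a S ⊗ P S w) Ts) ≈ a (decreasingTree w)
  sum-P a w Ts! ∈Ts = ≈-trans
    (sum-single id (λ S → a S ⊗ P S w) Ts! ∈Ts
        (λ {S} _ S≢ → ≈-trans (*-congˡ (≈-trans (P-δ S w) (δ-≢ S _ S≢))) (⊗-zeroʳ _)))
    (≈-trans (*-congˡ (≈-trans (P-δ (decreasingTree w) w) (δ-refl (decreasingTree w)))) (⊗-identityʳ _))

  sum-P-∉ : ∀ (a : Tree → Carrier) {Ts} w → decreasingTree w ∉ Ts → sumK (map (λ S → a S ⊗ P S w) Ts) ≈ 0#
  sum-P-∉ a {Ts} w ∉Ts = sum-zero Ts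
    (λ {S} S∈ → ≈-trans (*-congˡ (≈-trans (P-δ S w) (δ-≢ S _ (λ { refl → ∉Ts S∈ })))) (⊗-zeroʳ _))

  -- Unitriangular families

  -- `coeff T S` is the coefficient of `P S` in `g T`. The disjunction in `support` avoids deciding
  -- whether a coefficient vanishes; its `RootNoRight S` gives a contributing prefix the form
  -- `node l′ leaf` that `⊴-cut` requires.
  record Triangular (g : Tree → Ser) : Set (c ⊔ ℓ) where
    field
      coeff     : Tree → Tree → Carrier
      expansion : ∀ T w → g T w ≈ coeff T (decreasingTree w)
      diagonal  : ∀ T → RootNoRight T → coeff T T ≈ 1#
      support   : ∀ T → RootNoRight T → ∀ S → (S ⊴ T × RootNoRight S) ⊎ coeff T S ≈ 0#

  module _ {g : Tree → Ser} (triangular : Triangular g) where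
    open Triangular triangular

    -- A product is evaluated by cutting the word at the degree of each factor, and `≻-take` and
    -- `≻-drop` transfer these cuts to the tree.
    monoCoeff : List Tree → Tree → Carrier
    monoCoeff []       S = δ leaf S
    monoCoeff (T ∷ ts) S = coeff T (takeTree (size T) S) ⊗ monoCoeff ts (dropTree (size T) S)

    g-homogeneous : ∀ {T} → RootNoRight T → ∀ u → length u ≢ size T → g T u ≈ 0#
    g-homogeneous {T} rT u u≢ with support T rT (decreasingTree u)
    ... | inj₁ ((s , _) , _) = contradiction (trans (≻-size (≻-decreasingTree u)) s) u≢
    ... | inj₂ c≈0 = ≈-trans (expansion T u) c≈0

    mono-expansion : ∀ {ts} → GenWord ts → ∀ w → mono g ts w ≈ monoCoeff ts (decreasingTree w)
    mono-expansion [] [] = ≈-sym (δ-refl leaf)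
    mono-expansion [] (x ∷ w) = ≈-sym (δ-≢ leaf _
        (λ eq → contradiction (trans (≻-size (≻-decreasingTree (x ∷ w))) (cong size (sym eq))) λ ()))
    mono-expansion {T ∷ ts} (rT ∷ rts) w = ≈-trans
        (*S-homogeneous (size T) (g T) (mono g ts) (g-homogeneous rT) w)
      (*-cong (≈-trans (expansion T (take (size T) w))
          (≈-reflexive (cong (coeff T) (≻⇒≡ (≻-take (size T) (≻-decreasingTree w))))))
              (≈-trans (mono-expansion rts (drop (size T) w))
                  (≈-reflexive (cong (monoCoeff ts) (≻⇒≡ (≻-drop (size T) (≻-decreasingTree w)))))))

    monoCoeff-comb : ∀ {ts} → GenWord ts → monoCoeff ts (comb ts) ≈ 1#
    monoCoeff-comb [] = δ-refl leaf
    monoCoeff-comb {node l leaf ∷ ts} (rT ∷ rts) rewrite +-identityʳ (size l) | takeTree-root l (comb ts)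
        | dropTree-root l (comb ts) =
      ≈-trans (*-cong (diagonal (node l leaf) rT) (monoCoeff-comb rts)) (⊗-identityˡ 1#)

    -- Unless a factor vanishes, the first piece is some `node l′ leaf` with the size of `T`. Then
    -- `⊴-cut` bounds `S` by that piece with the remainder grafted on it, and `⊴-node` passes to `T`
    -- and `comb ts`.
    monoCoeff-support : ∀ {ts} → GenWord ts → ∀ S → S ⊴ comb ts ⊎ monoCoeff ts S ≈ 0#
    monoCoeff-support [] S with leaf ≟T S
    ... | yes refl = inj₁ ⊴-refl
    ... | no  _    = inj₂ ≈-refl
    monoCoeff-support {T@(node l leaf) ∷ ts} (rT ∷ rts) S
      with support T rT (takeTree (size T) S) | monoCoeff-support rts (dropTree (size T) S)
    ... | inj₂ z | _      = inj₂ (≈-trans (*-congʳ z) (⊗-zeroˡ _))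
    ... | inj₁ _ | inj₂ z = inj₂ (≈-trans (*-congˡ z) (⊗-zeroʳ _))
    ... | inj₁ (p , rS) | inj₁ q = inj₁ (go (takeTree (size T) S) refl p rS)
      where
      go : ∀ S′ → takeTree (size T) S ≡ S′ → S′ ⊴ T → RootNoRight S′ → S ⊴ comb (T ∷ ts)
      go (node l′ leaf) eq p _ = ⊴-trans
        (subst (λ n → S ⊴ node l′ (dropTree n S)) size≡
          (⊴-cut l′ S (trans (cong (λ n → takeTree n S) size≡) eq)))
        (⊴-node (⊴-node-leaf⁻ p) q)
        where
        size≡ : suc (size l′) ≡ size T
        size≡ = trans (cong suc (sym (+-identityʳ (size l′)))) (proj₁ p)

    -- The support consists of trees with the size of `comb ts`, so the expansion is a finite sum.
    mono-InPBT : ∀ {ts} → GenWord ts → InPBT (mono g ts)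
    mono-InPBT {ts} rts = map (λ S → monoCoeff ts S , S) Ts , λ w → ≈-trans (mono-expansion rts w) (≈-sym
      (≈-trans (≈-reflexive (trans (lin-apply P (map (λ S → monoCoeff ts S , S) Ts) w)
          (cong sumK (sym (map-∘ {g = λ p → proj₁ p ⊗ P (proj₂ p) w} {f = λ S → monoCoeff ts S , S} Ts)))))
          (sum≈ w)))
      where
      Ts = treesOfSize (size (comb ts))
      sum≈ : ∀ w → sumK (map (λ S → monoCoeff ts S ⊗ P S w) Ts) ≈ monoCoeff ts (decreasingTree w)
      sum≈ w with size (decreasingTree w) ≟ size (comb ts) | monoCoeff-support rts (decreasingTree w)
      ... | yes s | _ = sum-P (monoCoeff ts) w (treesOfSize-unique (size (comb ts)))
          (∈-treesOfSize (decreasingTree w) s)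
      ... | no ¬s | inj₁ (s , _) = contradiction s ¬s
      ... | no ¬s | inj₂ z = ≈-trans (sum-P-∉ (monoCoeff ts) w (¬s ∘ treesOfSize-size (size (comb ts))))
          (≈-sym z)

    -- Spanning: each `P T` as a combination of monomials

    InSpan : Ser → Set (c ⊔ ℓ)
    InSpan f = ∃ λ (cs : List (Carrier × List Tree)) → All (λ p → GenWord (proj₂ p)) cs × (f ≈S evalFree g cs)

    evalFree-++ : ∀ cs ds w → evalFree g (cs ++ ds) w ≈ evalFree g cs w ⊕ evalFree g ds w
    evalFree-++ [] ds w = ≈-sym (⊕-identityˡ _)
    evalFree-++ (p ∷ cs) ds w = ≈-trans (+-congˡ (evalFree-++ cs ds w)) (≈-sym (⊕-assoc _ _ _))

    evalFree-scale : ∀ a cs w → evalFree g (map (λ p → a ⊗ proj₁ p , proj₂ p) cs) w ≈ a ⊗ evalFree g cs w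
    evalFree-scale a [] w = ≈-sym (⊗-zeroʳ a)
    evalFree-scale a (p ∷ cs) w = ≈-trans (+-cong (⊗-assoc _ _ _) (evalFree-scale a cs w))
        (≈-sym (⊗-distribˡ-⊕ _ _ _))

    InSpan-mono : ∀ {ts} → GenWord ts → InSpan (mono g ts)
    InSpan-mono {ts} rts = (1# , ts) ∷ [] , rts ∷ [] , λ w → ≈-sym (≈-trans (⊕-identityʳ _) (⊗-identityˡ _))

    InSpan-+S : ∀ {f h} → InSpan f → InSpan h → InSpan (f +S h)
    InSpan-+S (cs , rcs , f≈) (ds , rds , h≈) = cs ++ ds , Allₚ.++⁺ rcs rds , λ w → ≈-trans
        (+-cong (f≈ w) (h≈ w)) (≈-sym (evalFree-++ cs ds w))

    InSpan-·S : ∀ a {f} → InSpan f → InSpan (a ·S f)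
    InSpan-·S a (cs , rcs , f≈) = _ , Allₚ.map⁺ rcs , λ w → ≈-trans (*-congˡ (f≈ w))
        (≈-sym (evalFree-scale a cs w))

    InSpan-sumS : ∀ {a} {A : Set a} (h : A → Ser) xs → (∀ {x} → x ∈ xs → InSpan (h x)) →
      InSpan (sumS (map h xs))
    InSpan-sumS h [] _ = [] , [] , λ _ → ≈-refl
    InSpan-sumS h (x ∷ xs) p = InSpan-+S (p (here refl)) (InSpan-sumS h xs (p ∘ there))

    smaller : Tree → List Tree
    smaller T = filter (λ S → treeInv S <? treeInv T) (treesOfSize (size T))

    ∈-smaller⁻ : ∀ {S} T → S ∈ smaller T → size S ≡ size T × treeInv S < treeInv T
    ∈-smaller⁻ T S∈ with ∈-filter⁻ (λ S → treeInv S <? treeInv T) {xs = treesOfSize (size T)} S∈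
    ... | S∈ₛ , S<T = treesOfSize-size (size T) S∈ₛ , S<T

    -- The monomial of `generators T` has leading tree `T` with coefficient 1; the rest of its
    -- expansion lies over `smaller T` and is subtracted.
    P-recursion : ∀ T → P T ≈S
      (mono g (generators T) +S sumS (map (λ S → (⊖ monoCoeff (generators T) S) ·S P S) (smaller T)))
    P-recursion T w = ≈-trans (P-δ T w) (≈-sym (≈-trans
      (+-cong (mono-expansion (generators-RootNoRight T) w)
          (≈-reflexive (sumS-apply (λ S → (⊖ m S) ·S P S) (smaller T) w))) expand))
      where
      m = monoCoeff (generators T)
      expand : m (decreasingTree w) ⊕ sumK (map (λ S → (⊖ m S) ⊗ P S w) (smaller T)) ≈ δ T (decreasingTree w)
      expand with T ≟T decreasingTree w
      ... | yes T≡ = ≈-trans (+-cong m≈1 (sum-P-∉ (λ S → ⊖ m S) w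
          (λ S∈ → <-irrefl (cong treeInv (sym T≡)) (proj₂ (∈-smaller⁻ T S∈))))) (⊕-identityʳ 1#)
        where
        m≈1 : m (decreasingTree w) ≈ 1#
        m≈1 = ≈-trans (≈-reflexive (cong m (trans (sym T≡) (sym (comb-generators T)))))
            (monoCoeff-comb (generators-RootNoRight T))
      ... | no T≢ with size (decreasingTree w) ≟ size T | treeInv (decreasingTree w) <? treeInv T
          | monoCoeff-support (generators-RootNoRight T) (decreasingTree w)
      ...   | yes s | yes i | _ = ≈-trans
                (+-congˡ (sum-P (λ S → ⊖ m S) w (Uniqueₚ.filter⁺ _ (treesOfSize-unique (size T)))
                    (∈-filter⁺ _ (∈-treesOfSize _ s) i)))
                (-‿inverseʳ _)
      ...   | no ¬s | _ | inj₂ z = ≈-trans (+-cong z (sum-P-∉ (λ S → ⊖ m S) w (¬s ∘ proj₁ ∘ ∈-smaller⁻ T)))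
          (⊕-identityʳ 0#)
      ...   | _ | no ¬i | inj₂ z = ≈-trans (+-cong z (sum-P-∉ (λ S → ⊖ m S) w (¬i ∘ proj₂ ∘ ∈-smaller⁻ T)))
          (⊕-identityʳ 0#)
      ...   | no ¬s | _ | inj₁ p rewrite comb-generators T = contradiction (proj₁ p) ¬s
      ...   | yes _ | no ¬i | inj₁ p rewrite comb-generators T with p
      ...     | _ , inj₁ eq = contradiction (sym eq) T≢
      ...     | _ , inj₂ i = contradiction i ¬i

    -- Strong induction on the number of inversions, with `n` as an explicit bound.
    P-InSpan-< : ∀ n T → treeInv T < n → InSpan (P T)
    P-InSpan-< (suc n) T (s≤s T≤n) with InSpan-+S (InSpan-mono (generators-RootNoRight T))
      (InSpan-sumS (λ S → (⊖ monoCoeff (generators T) S) ·S P S) (smaller T)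
        (λ {S} S∈ → InSpan-·S _ (P-InSpan-< n S (<-≤-trans (proj₂ (∈-smaller⁻ T S∈)) T≤n))))
    ... | cs , rcs , f≈ = cs , rcs , λ w → ≈-trans (P-recursion T w) (f≈ w)

    P-InSpan : ∀ T → InSpan (P T)
    P-InSpan T = P-InSpan-< (suc (treeInv T)) T ≤-refl

    -- Linear independence of the monomials

    module _ (cs : List (Carrier × List Tree)) (rcs : All (λ p → GenWord (proj₂ p)) cs)
             (cs! : Unique (map proj₂ cs)) (cs≈0 : evalFree g cs ≈S 0S) where

      combInv : Carrier × List Tree → ℕ
      combInv p = treeInv (comb (proj₂ p))

      sum≈0 : ∀ S → sumK (map (λ p → proj₁ p ⊗ mono g (proj₂ p) (treeWord S)) cs) ≈ 0#
      sum≈0 S = ≈-trans (≈-reflexive (sym (lin-apply (mono g) cs (treeWord S)))) (cs≈0 (treeWord S))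

      mono-treeWord : ∀ {ts} → GenWord ts → ∀ S → mono g ts (treeWord S) ≈ monoCoeff ts S
      mono-treeWord {ts} rts S = ≈-trans (mono-expansion rts (treeWord S))
          (≈-reflexive (cong (monoCoeff ts) (≻⇒≡ (treeWord-≻ S))))

      -- Evaluating at the comb of p isolates the coefficient of p once those of larger combInv are known to vanish.
      coefficient-zero : ∀ {p} → p ∈ cs → (∀ {q} → q ∈ cs → combInv p < combInv q → proj₁ q ≈ 0#) → proj₁ p ≈ 0#
      coefficient-zero {a , ts} p∈ larger≈0 = ≈-trans (≈-sym (≈-trans
        (sum-single proj₂ (λ q → proj₁ q ⊗ mono g (proj₂ q) (treeWord S)) (AllPairsₚ.map⁻ cs!) p∈ others≈0)
        (≈-trans (*-congˡ (≈-trans (mono-treeWord rts S) (monoCoeff-comb rts))) (⊗-identityʳ a))))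
        (sum≈0 S)
        where
        S = comb ts
        rts = All.lookup rcs p∈
        others≈0 : ∀ {q} → q ∈ cs → proj₂ q ≢ ts → proj₁ q ⊗ mono g (proj₂ q) (treeWord S) ≈ 0#
        others≈0 {b , us} q∈ us≢ts with monoCoeff-support (All.lookup rcs q∈) S
        ... | inj₂ z = ≈-trans (*-congˡ (≈-trans (mono-treeWord (All.lookup rcs q∈) S) z)) (⊗-zeroʳ b)
        ... | inj₁ (_ , inj₂ S<) = ≈-trans (*-congʳ (larger≈0 q∈ S<)) (⊗-zeroˡ _)
        ... | inj₁ (_ , inj₁ eq) = contradiction
                (trans (sym (generators-comb (All.lookup rcs q∈)))
                    (trans (cong generators (sym eq)) (generators-comb rts))) us≢ts

      coefficients-zero : All (λ p → proj₁ p ≈ 0#) cs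
      coefficients-zero = All.tabulate (λ {p} p∈ → descend (suc b) p∈ (m≤m+n (suc b) (combInv p)))
        where
        b = proj₁ (bound combInv cs)
        -- `n` limits how far `combInv` can still rise; at `zero` it would already exceed the bound
        -- `b`.
        descend : ∀ n {p} → p ∈ cs → b < n + combInv p → proj₁ p ≈ 0#
        descend zero p∈ b< = contradiction (proj₂ (bound combInv cs) p∈) (<⇒≱ b<)
        descend (suc n) {p} p∈ b< = coefficient-zero p∈
          (λ q∈ p<q → descend n q∈ (<-≤-trans b<
              (≤-trans (≤-reflexive (sym (+-suc n (combInv p)))) (+-monoʳ-≤ n p<q))))

    triangular⇒FreeOn : FreeOn g
    triangular⇒FreeOn = (λ ts → mono-InPBT) , P-InSpan , coefficients-zero

  -- Triangularity of the two families

  P-triangular : Triangular P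
  P-triangular = record
    { coeff = δ
    ; expansion = P-δ
    ; diagonal = λ T _ → δ-refl T
    ; support = support
    }
    where
    support : ∀ T → RootNoRight T → ∀ S → (S ⊴ T × RootNoRight S) ⊎ δ T S ≈ 0#
    support T rT S with T ≟T S
    ... | yes refl = inj₁ (⊴-refl , rT)
    ... | no  _    = inj₂ ≈-refl

  module _ (dec : ∀ u v → Dec (u ≤W v)) where

    below : Tree → List Tree
    below T = filter (λ S → dec (wT S) (wT T)) (treesOfSize (size T))

    ∈-below⁻ : ∀ {S} T → S ∈ below T → size S ≡ size T × wT S ≤W wT T
    ∈-below⁻ T S∈ with ∈-filter⁻ (λ S → dec (wT S) (wT T)) {xs = treesOfSize (size T)} S∈
    ... | S∈ₛ , S≤T = treesOfSize-size (size T) S∈ₛ , S≤T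

    -- The coefficient counts occurrences of `S` in `below T`: one for `T` itself by reflexivity,
    -- none outside the weak order ideal. Inside it, `≤W⇒⊴` controls inversions and `≤W-RootNoRight`
    -- the right child of the root.
    H-triangular : Triangular (H dec)
    H-triangular = record
      { coeff = coeff
      ; expansion = λ T w → ≈-trans (≈-reflexive (sumS-apply P (below T) w))
          (sum-cong (below T) (λ S → P-δ S w))
      ; diagonal = λ T _ → ≈-trans
          (sum-single id (λ S → δ S T) (Uniqueₚ.filter⁺ (λ S → dec (wT S) (wT T)) (treesOfSize-unique (size T)))
            (∈-filter⁺ (λ S → dec (wT S) (wT T)) (∈-treesOfSize T refl) ε) (λ {S} _ → δ-≢ S T))
          (δ-refl T)
      ; support = support
      }
      where
      coeff : Tree → Tree → Carrier
      coeff T S = sumK (map (λ S′ → δ S′ S) (below T))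
      support : ∀ T → RootNoRight T → ∀ S → (S ⊴ T × RootNoRight S) ⊎ coeff T S ≈ 0#
      support T rT S with size S ≟ size T | dec (wT S) (wT T)
      ... | yes s | yes S≤T = inj₁ (≤W⇒⊴ s S≤T , ≤W-RootNoRight s S≤T rT)
      ... | no ¬s | _       = inj₂ (sum-zero (below T)
          (λ {S′} S′∈ → δ-≢ S′ S (λ { refl → ¬s (proj₁ (∈-below⁻ T S′∈)) })))
      ... | _     | no S≰T  = inj₂ (sum-zero (below T)
          (λ {S′} S′∈ → δ-≢ S′ S (λ { refl → S≰T (proj₂ (∈-below⁻ T S′∈)) })))

mainTheorem13 : ∀ {c ℓ : Level} (K : CommutativeRing c ℓ) →
    FieldDefs.IsFieldChar0 K →
    (dec : ∀ u v → Dec (u ≤W v)) →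
    Series.FreeOn K (Series.P K) × Series.FreeOn K (Series.H K dec)
mainTheorem13 K _ dec = triangular⇒FreeOn P-triangular , triangular⇒FreeOn (H-triangular dec)
  where open PBT K
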